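{- Let $d \geq 1$ and $n \geq 3$ be integers, and let $L:(\mathbb{Z}/n\mathbb{Z})^d \to \{\mathsf{C},\mathsf{A},\mathsf{T}\}$ be any labeling. Then the number of occurrences of $\mathsf{CAT}$ in $L$ is at most $(3^{d-1}/2)n^d$. Moreover, equality is attained if and only if $n$ is a multiple of $4$ and $L$ is a generalized Patchell--Spiro labeling.
   Context: An occurrence of $\mathsf{CAT}$ in a labeling $L$ of $(\mathbb{Z}/n\mathbb{Z})^d$ is a pair $(x,y)$ with $x \in (\mathbb{Z}/n\mathbb{Z})^d$ and $y \in \{ -1,0,1\}^d \setminus \{0\}$ such that $L(x)=\mathsf{C}$, $L(x+y)=\mathsf{A}$, $L(x+2y)=\mathsf{T}$; the number of occurrences is the number of such pairs. Suppose $n$ is a multiple of $4$ (so reductions of elements of $\mathbb{Z}/n\mathbb{Z}$ modulo $2$ and modulo $4$ are well defined). A generalized Patchell--Spiro labeling is a labeling of the following form: there exist a coordinate index $r \in \{1,\ldots,d\}$, a translation vector $a \in (\mathbb{Z}/n\mathbb{Z})^d$, and a choice of $\epsilon_y \in \{1,3\}$ for each $y \in \{0,1\}^{d-1}$, such that for every $x \in (\mathbb{Z}/n\mathbb{Z})^d$, writing $z = x-a$, $s = z_r$, and $y \in \{0,1\}^{d-1}$ for the reduction modulo $2$ of the vector obtained from $z$ by deleting its $r$-th coordinate: $L(x)=\mathsf{A}$ if $s$ is even; $L(x)=\mathsf{C}$ if $s$ is odd and $s \equiv \epsilon_y \pmod 4$; and $L(x)=\mathsf{T}$ if $s$ is odd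 and $s \equiv \epsilon_y + 2 \pmod 4$. -}

module Defs where

open import Data.Nat using (ℕ; zero; suc; _+_; _*_; _∸_; _%_; _≡ᵇ_)
open import Data.Nat.DivMod using (_mod_)
open import Data.Fin using (Fin; toℕ)
open import Data.Vec using (Vec; []; _∷_; zipWith; removeAt; lookup)
import Data.Vec as Vec
open import Data.List using (List; []; _∷_; map; concatMap; allFin)
open import Data.Nat.ListAction using (sum)
open import Data.Bool using (Bool; true; false; if_then_else_; _∧_; _∨_)
open import Data.Product using (Σ; _×_)
open import Data.Empty using (⊥)
open import Relation.Binary.PropositionalEquality using (_≡_)

data Label : Set where
  C A T : Label

isC isA isT : Label → Bool
isC C = true
isC _ = false
isA A = true
isA _ = false
isT T = true
isT _ = false

Point : ℕ → ℕ → Set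
Point d n = Vec (Fin n) d

Labeling : ℕ → ℕ → Set
Labeling d n = Point d n → Label

data Dir : Set where
  minus zer plus : Dir

Direction : ℕ → Set
Direction d = Vec Dir d

isNonzeroDir : Dir → Bool
isNonzeroDir zer = false
isNonzeroDir _   = true

nonzero : ∀ {d} → Direction d → Bool
nonzero [] = false
nonzero (e ∷ y) = isNonzeroDir e ∨ nonzero y

addDir : ∀ {n} → Fin n → Dir → Fin n
addDir {suc m} i minus = (toℕ i + m) mod (suc m)
addDir {suc m} i zer   = i
addDir {suc m} i plus  = (toℕ i + 1) mod (suc m)

_⊕_ : ∀ {d n} → Point d n → Direction d → Point d n
x ⊕ y = zipWith addDir x y

subFin : ∀ {n} → Fin n → Fin n → Fin n
subFin {suc m} i j = (toℕ i + (suc m ∸ toℕ j)) mod (suc m)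

_⊖_ : ∀ {d n} → Point d n → Point d n → Point d n
x ⊖ a = zipWith subFin x a

allVecs : ∀ {A : Set} (d : ℕ) → List A → List (Vec A d)
allVecs zero    as = [] ∷ []
allVecs (suc d) as = concatMap (λ a → map (a ∷_) (allVecs d as)) as

allPoints : (d n : ℕ) → List (Point d n)
allPoints d n = allVecs d (allFin n)

allDirections : (d : ℕ) → List (Direction d)
allDirections d = allVecs d (minus ∷ zer ∷ plus ∷ [])

catIndicator : ∀ {d n} → Labeling d n → Point d n → Direction d → ℕ
catIndicator L x y =
  if nonzero y ∧ isC (L x) ∧ isA (L (x ⊕ y)) ∧ isT (L ((x ⊕ y) ⊕ y))
  then 1 else 0

occurrences : ∀ {d n} → Labeling d n → ℕ
occurrences {d} {n} L =
  sum (map (λ x → sum (map (λ y → catIndicator L x y) (allDirections d)))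
           (allPoints d n))

data Eps : Set where
  one three : Eps

epsVal : Eps → ℕ
epsVal one   = 1
epsVal three = 3

psLabel : ∀ {d' n} → Fin (suc d') → Point (suc d') n →
          (Vec (Fin 2) d' → Eps) → Point (suc d') n → Label
psLabel r a ε x =
  let z = x ⊖ a
      s = toℕ (lookup z r)
      y = Vec.map (λ t → toℕ t mod 2) (removeAt z r)
  in if s % 2 ≡ᵇ 0 then A
     else if s % 4 ≡ᵇ epsVal (ε y) then C
     else T

-- L is a generalized Patchell–Spiro labeling (meaningful when 4 ∣ n, d ≥ 1).
GenPS : ∀ {d n} → Labeling d n → Set
GenPS {zero}   L = ⊥
GenPS {suc d'} {n} L =
  Σ (Fin (suc d')) λ r →
  Σ (Point (suc d') n) λ a →
  Σ (Vec (Fin 2) d' → Eps) λ ε →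
  ∀ x → L x ≡ psLabel r a ε x

{-# OPTIONS --safe #-}

-- Write f = 1 on the letter A and f = −1 elsewhere.  An occurrence of CAT centred at p uses the two edges from
-- p to p ± y of the king's graph, both of which leave A, so twice the number of occurrences is at most the
-- number of ordered edges from A to its complement.  That cut has size (3ᵈ nᵈ − B(f,f)) / 4, where
-- B(f,g) = Σ_p Σ_y f(p) g(p + y) over y ∈ {−1,0,1}ᵈ, so one needs −3ᵈ⁻¹ ‖f‖² ≤ B(f,f).  This is proved together
-- with B(f,f) ≤ 3ᵈ ‖f‖² by induction on d: with f_i the slices of f along the first coordinate,
--   4 B(f,f) = 3 Σ_i B(f_i + f_{i+1}, f_i + f_{i+1}) − Σ_i B(f_i − f_{i+1}, f_i − f_{i+1}),
-- and the parallelogram law treats ‖f‖² alike.  These are identities, so the equality cases can be read off: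
-- the upper bound is attained by constants only, and a ±1-valued f attaining the lower bound alternates in one
-- coordinate and ignores the others.  Equality in the first step then forces L(q + 2y) to be the opposite of
-- L(q) whenever q is not labelled A and y moves along the alternating coordinate.

module Submission where

open import Defs
open import Data.Bool using (true; false; if_then_else_; _∧_)
open import Data.Fin using (Fin; zero; suc; toℕ)
open import Data.Fin.Permutation using (permutation)
open import Data.Fin.Properties using (toℕ-fromℕ<; toℕ-injective; toℕ<n; toℕ≤n; any?; all?)
open import Data.Integer using (ℤ; +_; -[1+_]; _+_; _*_; _-_; -_; _≤_; 0ℤ; 1ℤ; -1ℤ; +≤+; _≤?_; _≟_)
open import Data.Integer.Properties
open import Data.Integer.Tactic.RingSolver using (solve-∀)
open import Data.List using (List; []; _∷_; _++_; map; concatMap; allFin; tabulate; length)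
open import Data.List.Membership.Propositional using (_∈_)
open import Data.List.Membership.Propositional.Properties using (∈-map⁺; ∈-concatMap⁺; ∈-allFin)
open import Data.List.Properties using (length-tabulate)
open import Data.List.Relation.Unary.Any using (here; there)
import Data.List.Relation.Unary.Any as Any
open import Data.Nat using (ℕ; zero; suc; NonZero; _≡ᵇ_)
import Data.Nat as ℕ
open import Data.Nat.DivMod using (_mod_; _%_; _/_; m%n<n; m%n%n≡m%n; %-distribˡ-+; [m+n]%n≡m%n; m<n⇒m%n≡m; m≡m%n+[m/n]*n; m∣n⇒o%n%m≡o%m)
open import Data.Nat.Divisibility using (_∣_; divides; m%n≡0⇒n∣m; ∣-trans)
open import Data.Nat.ListAction using (sum)
import Data.Nat.Properties as ℕ
open import Data.Product using (Σ; ∃; _×_; _,_; proj₁; proj₂)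
open import Data.Sum using (_⊎_; inj₁; inj₂; [_,_]′)
open import Data.Vec using (Vec; []; _∷_; lookup; replicate; insertAt; removeAt)
import Data.Vec as Vec
open import Data.Vec.Properties using (lookup-map; lookup-zipWith; lookup-replicate; insertAt-lookup; insertAt-removeAt)
open import Function using (_∘_; id)
open import Function.Bundles using (_⇔_; mk⇔)
open import Relation.Binary.PropositionalEquality
open import Relation.Nullary using (Dec; yes; no; ¬?; contradiction)
open import Relation.Nullary.Decidable using (toWitness; decidable-stable)
open import Algebra.Properties.AbelianGroup +-0-abelianGroup using () renaming (∙-cancelˡ to +-cancelˡ-≡)
open import Algebra.Properties.CommutativeMonoid.Sum +-0-commutativeMonoid using (sum-permute) renaming (sum to sumᶠ)

+-nonneg-zeroˡ : ∀ {a b} → 0ℤ ≤ a → 0ℤ ≤ b → a + b ≡ 0ℤ → a ≡ 0ℤ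
+-nonneg-zeroˡ {+ zero}  (+≤+ _) (+≤+ _) _  = refl
+-nonneg-zeroˡ {+ suc _} (+≤+ _) (+≤+ _) ()

+-nonneg-zeroʳ : ∀ {a b} → 0ℤ ≤ a → 0ℤ ≤ b → a + b ≡ 0ℤ → b ≡ 0ℤ
+-nonneg-zeroʳ {a} {b} 0≤a 0≤b eq = +-nonneg-zeroˡ 0≤b 0≤a (trans (+-comm b a) eq)

-- Finite sums

private variable
  X Y : Set

-- Opaque, since sums over allFin (suc m) would otherwise unfold during unification.
opaque

  ∑ : {X : Set} → List X → (X → ℤ) → ℤ
  ∑ []       f = 0ℤ
  ∑ (x ∷ xs) f = f x + ∑ xs f

opaque

  unfolding ∑

  ∑-cong : (xs : List X) {f g : X → ℤ} → (∀ x → f x ≡ g x) → ∑ xs f ≡ ∑ xs g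
  ∑-cong []       f≗g = refl
  ∑-cong (x ∷ xs) f≗g = cong₂ _+_ (f≗g x) (∑-cong xs f≗g)

  ∑-+ : (xs : List X) (f g : X → ℤ) → ∑ xs (λ x → f x + g x) ≡ ∑ xs f + ∑ xs g
  ∑-+ []       f g = refl
  ∑-+ (x ∷ xs) f g = trans (cong (_+_ (f x + g x)) (∑-+ xs f g)) (interchange (f x) (g x) (∑ xs f) (∑ xs g))
    where
    interchange : ∀ a b c d → (a + b) + (c + d) ≡ (a + c) + (b + d)
    interchange = solve-∀

  ∑-* : (xs : List X) (c : ℤ) (f : X → ℤ) → ∑ xs (λ x → c * f x) ≡ c * ∑ xs f
  ∑-* []       c f = sym (*-zeroʳ c)
  ∑-* (x ∷ xs) c f = trans (cong (_+_ (c * f x)) (∑-* xs c f)) (sym (*-distribˡ-+ c (f x) (∑ xs f)))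

  ∑-++ : (xs ys : List X) (f : X → ℤ) → ∑ (xs ++ ys) f ≡ ∑ xs f + ∑ ys f
  ∑-++ []       ys f = sym (+-identityˡ _)
  ∑-++ (x ∷ xs) ys f = trans (cong (_+_ (f x)) (∑-++ xs ys f)) (sym (+-assoc (f x) _ _))

  ∑-const : (xs : List X) (c : ℤ) → ∑ xs (λ _ → c) ≡ + length xs * c
  ∑-const []       c = sym (*-zeroˡ c)
  ∑-const (x ∷ xs) c = trans (cong (_+_ c) (∑-const xs c)) (sym (suc-* (+ length xs) c))

  ∑-nonneg : (xs : List X) {f : X → ℤ} → (∀ x → 0ℤ ≤ f x) → 0ℤ ≤ ∑ xs f
  ∑-nonneg []       0≤f = ≤-refl
  ∑-nonneg (x ∷ xs) 0≤f = +-mono-≤ (0≤f x) (∑-nonneg xs 0≤f)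

  -- All equality cases are read off through this: each inequality is proved by exhibiting its
  -- defect as a sum of nonnegative terms.
  ∑-nonneg-zero : (xs : List X) {f : X → ℤ} → (∀ x → 0ℤ ≤ f x) → ∑ xs f ≡ 0ℤ → ∀ {x} → x ∈ xs → f x ≡ 0ℤ
  ∑-nonneg-zero (_ ∷ xs) 0≤f eq (here refl) = +-nonneg-zeroˡ (0≤f _) (∑-nonneg xs 0≤f) eq
  ∑-nonneg-zero (_ ∷ xs) 0≤f eq (there x∈)  =
    ∑-nonneg-zero xs 0≤f (+-nonneg-zeroʳ (0≤f _) (∑-nonneg xs 0≤f) eq) x∈

  pos-sum : (xs : List X) (f : X → ℕ) → + sum (map f xs) ≡ ∑ xs (λ x → + f x)
  pos-sum []       f = refl
  pos-sum (x ∷ xs) f = trans (pos-+ (f x) _) (cong (_+_ (+ f x)) (pos-sum xs f))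


  ∑-map : (xs : List X) (h : X → Y) (f : Y → ℤ) → ∑ (map h xs) f ≡ ∑ xs (f ∘ h)
  ∑-map []       h f = refl
  ∑-map (x ∷ xs) h f = cong (_+_ (f (h x))) (∑-map xs h f)

  ∑-concatMap : (xs : List X) (h : X → List Y) (f : Y → ℤ) →
    ∑ (concatMap h xs) f ≡ ∑ xs (λ x → ∑ (h x) f)
  ∑-concatMap []       h f = refl
  ∑-concatMap (x ∷ xs) h f = trans (∑-++ (h x) _ f) (cong (_+_ (∑ (h x) f)) (∑-concatMap xs h f))

  ∑-swap : (xs : List X) (ys : List Y) (f : X → Y → ℤ) →
    ∑ xs (λ x → ∑ ys (f x)) ≡ ∑ ys (λ y → ∑ xs (λ x → f x y))
  ∑-swap []       ys f = sym (trans (∑-const ys 0ℤ) (*-zeroʳ (+ length ys)))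
  ∑-swap (x ∷ xs) ys f = trans (cong (_+_ (∑ ys (f x))) (∑-swap xs ys f)) (sym (∑-+ ys (f x) _))

  ∑-tabulate : ∀ {n} (h : Fin n → X) (f : X → ℤ) → ∑ (tabulate h) f ≡ sumᶠ (f ∘ h)
  ∑-tabulate {n = zero}  h f = refl
  ∑-tabulate {n = suc n} h f = cong (_+_ (f (h zero))) (∑-tabulate (h ∘ suc) f)

  ∑-singleton : (x : X) (f : X → ℤ) → ∑ (x ∷ []) f ≡ f x
  ∑-singleton x f = +-identityʳ (f x)

  ∑-dirs : (f : Dir → ℤ) → ∑ (minus ∷ zer ∷ plus ∷ []) f ≡ f minus + (f zer + f plus)
  ∑-dirs f = cong (λ t → f minus + (f zer + t)) (+-identityʳ (f plus))

∑-allVecs : ∀ d (as : List X) (f : Vec X (suc d) → ℤ) →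
  ∑ (allVecs (suc d) as) f ≡ ∑ as (λ a → ∑ (allVecs d as) (λ v → f (a ∷ v)))
∑-allVecs d as f = trans (∑-concatMap as _ f) (∑-cong as λ a → ∑-map (allVecs d as) (a ∷_) f)

∑-allVecs-const : ∀ d (as : List X) (c : ℤ) →
  ∑ (allVecs d as) (λ _ → c) ≡ + (length as ℕ.^ d) * c
∑-allVecs-const zero    as c = trans (∑-singleton [] _) (sym (*-identityˡ c))
∑-allVecs-const (suc d) as c = begin
  ∑ (allVecs (suc d) as) (λ _ → c)           ≡⟨ ∑-allVecs d as _ ⟩
  ∑ as (λ _ → ∑ (allVecs d as) (λ _ → c))    ≡⟨ ∑-const as _ ⟩
  + length as * ∑ (allVecs d as) (λ _ → c)   ≡⟨ cong (+ length as *_) (∑-allVecs-const d as c) ⟩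
  + length as * (+ (length as ℕ.^ d) * c)    ≡⟨ *-assoc (+ length as) _ c ⟨
  + length as * + (length as ℕ.^ d) * c      ≡⟨ cong (_* c) (pos-* (length as) _) ⟨
  + (length as ℕ.^ suc d) * c                ∎
  where open ≡-Reasoning

∈-allVecs : {as : List X} → (∀ a → a ∈ as) → ∀ {d} (v : Vec X d) → v ∈ allVecs d as
∈-allVecs ∈as []      = here refl
∈-allVecs ∈as (a ∷ v) = ∈-concatMap⁺ _ (Any.map (λ { refl → ∈-map⁺ (a ∷_) (∈-allVecs ∈as v) }) (∈as a))

∈-dirs : ∀ e → e ∈ minus ∷ zer ∷ plus ∷ []
∈-dirs minus = here refl
∈-dirs zer   = there (here refl)
∈-dirs plus  = there (there (here refl))

∈-points : ∀ {d n} (p : Point d n) → p ∈ allPoints d n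
∈-points = ∈-allVecs ∈-allFin

∈-directions : ∀ {d} (y : Direction d) → y ∈ allDirections d
∈-directions = ∈-allVecs ∈-dirs

∑-points-const : ∀ d n (c : ℤ) → ∑ (allPoints d n) (λ _ → c) ≡ + (n ℕ.^ d) * c
∑-points-const d n c = trans (∑-allVecs-const d (allFin n) c)
  (cong (λ k → + (k ℕ.^ d) * c) (length-tabulate {n = n} id))

∑-allFin-bij : ∀ {n} (π ρ : Fin n → Fin n) → (∀ i → π (ρ i) ≡ i) → (∀ i → ρ (π i) ≡ i) →
  (f : Fin n → ℤ) → ∑ (allFin n) (f ∘ π) ≡ ∑ (allFin n) f
∑-allFin-bij π ρ πρ ρπ f = trans (∑-tabulate id (f ∘ π)) (trans
  (sym (sum-permute f (permutation π ρ πρ ρπ))) (sym (∑-tabulate id f)))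

-- Arithmetic on the discrete torus

neg : Dir → Dir
neg minus = plus
neg zer   = zer
neg plus  = minus

negate : ∀ {d} → Direction d → Direction d
negate = Vec.map neg

negate-involutive : ∀ {d} (y : Direction d) → negate (negate y) ≡ y
negate-involutive []          = refl
negate-involutive (minus ∷ y) = cong (minus ∷_) (negate-involutive y)
negate-involutive (zer   ∷ y) = cong (zer ∷_) (negate-involutive y)
negate-involutive (plus  ∷ y) = cong (plus ∷_) (negate-involutive y)

toℕ-mod : ∀ k n .{{_ : NonZero n}} → toℕ (k mod n) ≡ k % n
toℕ-mod k n = toℕ-fromℕ< (m%n<n k n)

[m%n+o]%n≡[m+o]%n : ∀ k l n .{{_ : NonZero n}} → (k % n ℕ.+ l) % n ≡ (k ℕ.+ l) % n
[m%n+o]%n≡[m+o]%n k l n = begin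
  (k % n ℕ.+ l) % n            ≡⟨ %-distribˡ-+ (k % n) l n ⟩
  (k % n % n ℕ.+ l % n) % n    ≡⟨ cong (λ t → (t ℕ.+ l % n) % n) (m%n%n≡m%n k n) ⟩
  (k % n ℕ.+ l % n) % n        ≡⟨ %-distribˡ-+ k l n ⟨
  (k ℕ.+ l) % n                ∎
  where open ≡-Reasoning

module _ {m : ℕ} where

  private n = suc m

  next : Fin n → Fin n
  next i = addDir i plus

  -- Iterating `next` replaces modular arithmetic by induction on the number of steps; `toℕ-shift`
  -- translates back.
  shift : Fin n → ℕ → Fin n
  shift i zero    = i
  shift i (suc k) = next (shift i k)

  toℕ%n : (i : Fin n) → toℕ i % n ≡ toℕ i
  toℕ%n i = m<n⇒m%n≡m (toℕ<n i)

  toℕ-+n : (i : Fin n) → (toℕ i ℕ.+ n) % n ≡ toℕ i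
  toℕ-+n i = trans ([m+n]%n≡m%n (toℕ i) n) (toℕ%n i)

  -- Since n is `suc m`, adding m is subtracting 1 modulo n, and a step followed by its opposite
  -- adds n in total.
  addDir-neg : ∀ e (i : Fin n) → addDir (addDir i e) (neg e) ≡ i
  addDir-neg zer   i = refl
  addDir-neg plus  i = toℕ-injective (begin
    toℕ ((toℕ (next i) ℕ.+ m) mod n)     ≡⟨ toℕ-mod (toℕ (next i) ℕ.+ m) n ⟩
    (toℕ (next i) ℕ.+ m) % n             ≡⟨ cong (λ t → (t ℕ.+ m) % n) (toℕ-mod (toℕ i ℕ.+ 1) n) ⟩
    ((toℕ i ℕ.+ 1) % n ℕ.+ m) % n        ≡⟨ [m%n+o]%n≡[m+o]%n (toℕ i ℕ.+ 1) m n ⟩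
    (toℕ i ℕ.+ 1 ℕ.+ m) % n              ≡⟨ cong (_% n) (ℕ.+-assoc (toℕ i) 1 m) ⟩
    (toℕ i ℕ.+ n) % n                    ≡⟨ toℕ-+n i ⟩
    toℕ i                                ∎)
    where open ≡-Reasoning
  addDir-neg minus i = toℕ-injective (begin
    toℕ (next (addDir i minus))          ≡⟨ toℕ-mod (toℕ (addDir i minus) ℕ.+ 1) n ⟩
    (toℕ (addDir i minus) ℕ.+ 1) % n     ≡⟨ cong (λ t → (t ℕ.+ 1) % n) (toℕ-mod (toℕ i ℕ.+ m) n) ⟩
    ((toℕ i ℕ.+ m) % n ℕ.+ 1) % n        ≡⟨ [m%n+o]%n≡[m+o]%n (toℕ i ℕ.+ m) 1 n ⟩
    (toℕ i ℕ.+ m ℕ.+ 1) % n              ≡⟨ cong (_% n) (trans (ℕ.+-assoc (toℕ i) m 1) (cong (toℕ i ℕ.+_) (ℕ.+-comm m 1))) ⟩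
    (toℕ i ℕ.+ n) % n                    ≡⟨ toℕ-+n i ⟩
    toℕ i                                ∎)
    where open ≡-Reasoning

  neg-addDir : ∀ e (i : Fin n) → addDir (addDir i (neg e)) e ≡ i
  neg-addDir minus = addDir-neg plus
  neg-addDir zer   = addDir-neg zer
  neg-addDir plus  = addDir-neg minus

  toℕ-shift : ∀ i k → toℕ (shift i k) ≡ (toℕ i ℕ.+ k) % n
  toℕ-shift i zero    = sym (trans (cong (_% n) (ℕ.+-identityʳ (toℕ i))) (toℕ%n i))
  toℕ-shift i (suc k) = begin
    toℕ (next (shift i k))               ≡⟨ toℕ-mod (toℕ (shift i k) ℕ.+ 1) n ⟩
    (toℕ (shift i k) ℕ.+ 1) % n          ≡⟨ cong (λ t → (t ℕ.+ 1) % n) (toℕ-shift i k) ⟩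
    ((toℕ i ℕ.+ k) % n ℕ.+ 1) % n        ≡⟨ [m%n+o]%n≡[m+o]%n (toℕ i ℕ.+ k) 1 n ⟩
    (toℕ i ℕ.+ k ℕ.+ 1) % n              ≡⟨ cong (_% n) (trans (ℕ.+-assoc (toℕ i) k 1) (cong (toℕ i ℕ.+_) (ℕ.+-comm k 1))) ⟩
    (toℕ i ℕ.+ suc k) % n                ∎
    where open ≡-Reasoning

  shift-n : ∀ i → shift i n ≡ i
  shift-n i = toℕ-injective (trans (toℕ-shift i n) (toℕ-+n i))

  shift-subFin : ∀ a i → shift a (toℕ (subFin i a)) ≡ i
  shift-subFin a i = toℕ-injective (begin
    toℕ (shift a (toℕ (subFin i a)))               ≡⟨ toℕ-shift a _ ⟩
    (toℕ a ℕ.+ toℕ (subFin i a)) % n               ≡⟨ cong (_% n) (ℕ.+-comm (toℕ a) _) ⟩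
    (toℕ (subFin i a) ℕ.+ toℕ a) % n               ≡⟨ cong (λ t → (t ℕ.+ toℕ a) % n) (toℕ-mod (toℕ i ℕ.+ (n ℕ.∸ toℕ a)) n) ⟩
    ((toℕ i ℕ.+ (n ℕ.∸ toℕ a)) % n ℕ.+ toℕ a) % n  ≡⟨ [m%n+o]%n≡[m+o]%n (toℕ i ℕ.+ (n ℕ.∸ toℕ a)) (toℕ a) n ⟩
    (toℕ i ℕ.+ (n ℕ.∸ toℕ a) ℕ.+ toℕ a) % n        ≡⟨ cong (_% n) (ℕ.+-assoc (toℕ i) _ _) ⟩
    (toℕ i ℕ.+ (n ℕ.∸ toℕ a ℕ.+ toℕ a)) % n        ≡⟨ cong (λ t → (toℕ i ℕ.+ t) % n) (ℕ.m∸n+n≡m (toℕ≤n a)) ⟩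
    (toℕ i ℕ.+ n) % n                              ≡⟨ toℕ-+n i ⟩
    toℕ i                                          ∎)
    where open ≡-Reasoning

  -- The cycle is a single orbit of `next`: by `shift-subFin`, j is reached from i in `subFin j i`
  -- steps.
  cyclic-induction : (P : Fin n → Set) → (∀ i → P i → P (next i)) → ∀ {i} → P i → ∀ j → P j
  cyclic-induction P step {i} Pi j = subst P (shift-subFin i j) (along (toℕ (subFin j i)))
    where
    along : ∀ k → P (shift i k)
    along zero    = Pi
    along (suc k) = step _ (along k)

  ⊕-negate : ∀ {d} (p : Point d n) y → (p ⊕ y) ⊕ negate y ≡ p
  ⊕-negate []      []      = refl
  ⊕-negate (i ∷ p) (e ∷ y) = cong₂ _∷_ (addDir-neg e i) (⊕-negate p y)

  ∑-addDir : ∀ e (f : Fin n → ℤ) → ∑ (allFin n) (λ i → f (addDir i e)) ≡ ∑ (allFin n) f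
  ∑-addDir e = ∑-allFin-bij (λ i → addDir i e) (λ i → addDir i (neg e)) (neg-addDir e) (addDir-neg e)

  ∑-translate : ∀ {d} (y : Direction d) (f : Point d n → ℤ) →
    ∑ (allPoints d n) (λ p → f (p ⊕ y)) ≡ ∑ (allPoints d n) f
  ∑-translate {zero}  []      f = trans (∑-singleton [] _) (sym (∑-singleton [] f))
  ∑-translate {suc d} (e ∷ y) f = begin
    ∑ (allPoints (suc d) n) (λ p → f (p ⊕ (e ∷ y)))                               ≡⟨ ∑-allVecs d (allFin n) _ ⟩
    ∑ (allFin n) (λ i → ∑ (allPoints d n) (λ v → f (addDir i e ∷ (v ⊕ y))))       ≡⟨ ∑-cong (allFin n) (λ i → ∑-translate y (λ v → f (addDir i e ∷ v))) ⟩
    ∑ (allFin n) (λ i → ∑ (allPoints d n) (λ v → f (addDir i e ∷ v)))             ≡⟨ ∑-addDir e (λ i → ∑ (allPoints d n) (λ v → f (i ∷ v))) ⟩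
    ∑ (allFin n) (λ i → ∑ (allPoints d n) (λ v → f (i ∷ v)))                      ≡⟨ ∑-allVecs d (allFin n) f ⟨
    ∑ (allPoints (suc d) n) f                                                     ∎
    where open ≡-Reasoning

∑-negate : ∀ {d} (f : Direction d → ℤ) → ∑ (allDirections d) (f ∘ negate) ≡ ∑ (allDirections d) f
∑-negate {zero}  f = trans (∑-singleton [] _) (sym (∑-singleton [] f))
∑-negate {suc d} f = begin
  ∑ (allDirections (suc d)) (f ∘ negate)          ≡⟨ ∑-allVecs d dirs _ ⟩
  ∑ dirs (λ e → ∑ (allDirections d) (λ y → f (neg e ∷ negate y)))
                                                  ≡⟨ ∑-cong dirs (λ e → ∑-negate (λ y → f (neg e ∷ y))) ⟩
  ∑ dirs (λ e → F (neg e))                        ≡⟨ trans (∑-dirs (F ∘ neg)) (trans (reverse (F plus) (F zer) (F minus)) (sym (∑-dirs F))) ⟩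
  ∑ dirs F                                        ≡⟨ ∑-allVecs d dirs f ⟨
  ∑ (allDirections (suc d)) f                     ∎
  where
  open ≡-Reasoning
  dirs = minus ∷ zer ∷ plus ∷ []
  F : Dir → ℤ
  F e = ∑ (allDirections d) (λ y → f (e ∷ y))
  reverse : ∀ a b c → a + (b + c) ≡ c + (b + a)
  reverse = solve-∀

-- The quadratic form of the king's graph

0≤i*i : ∀ i → 0ℤ ≤ i * i
0≤i*i (+ k)      = subst (0ℤ ≤_) (pos-* k k) (+≤+ ℕ.z≤n)
0≤i*i (-[1+ k ]) = +≤+ ℕ.z≤n

i*i≡0⇒i≡0 : ∀ i → i * i ≡ 0ℤ → i ≡ 0ℤ
i*i≡0⇒i≡0 i eq = [ id , id ]′ (i*j≡0⇒i≡0∨j≡0 i eq)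

0≤*⁺ : ∀ k {i} → 0ℤ ≤ i → 0ℤ ≤ + k * i
0≤*⁺ k {+ l} (+≤+ _) = subst (0ℤ ≤_) (pos-* k l) (+≤+ ℕ.z≤n)

module _ {m : ℕ} where

  private n = suc m

  form : ∀ {d} → (f g : Point d n → ℤ) → ℤ
  form {d} f g = ∑ (allPoints d n) λ p → ∑ (allDirections d) λ y → f p * g (p ⊕ y)

  norm² : ∀ {d} → (Point d n → ℤ) → ℤ
  norm² {d} f = ∑ (allPoints d n) λ p → f p * f p

  -- The defects of -3ᵈ⁻¹ ‖f‖² ≤ B(f,f) and B(f,f) ≤ 3ᵈ ‖f‖². The first is multiplied by 3, which
  -- avoids the exponent d - 1 and makes sense for d = 0.
  lower upper : ∀ {d} → (Point d n → ℤ) → ℤ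
  lower {d} f = + (3 ℕ.^ d) * norm² f + + 3 * form f f
  upper {d} f = + (3 ℕ.^ d) * norm² f - form f f

  slice : ∀ {d} → (Point (suc d) n → ℤ) → Fin n → Point d n → ℤ
  slice f i v = f (i ∷ v)

  _⟨_⟩_ : ∀ {d} → (Point d n → ℤ) → ℤ → (Point d n → ℤ) → Point d n → ℤ
  (f ⟨ s ⟩ g) p = f p + s * g p

  -- A symbolic s treats sums (s = 1) and differences (s = -1) of slices at once. Both cross terms
  -- are kept, as this is the shape in which `form-slices` produces them.
  form-pencil : ∀ {d} s (f g : Point d n → ℤ) →
    form (f ⟨ s ⟩ g) (f ⟨ s ⟩ g) ≡ form f f + s * (form f g + form g f) + s * s * form g g
  form-pencil {d} s f g = begin
    form (f ⟨ s ⟩ g) (f ⟨ s ⟩ g)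
      ≡⟨ ∑-cong ps (λ p → ∑-cong ys (λ y → expand (f p) (g p) (f (p ⊕ y)) (g (p ⊕ y)) s)) ⟩
    (∑ ps λ p → ∑ ys λ y → ff p y + s * (fg p y + gf p y) + s * s * gg p y)
      ≡⟨ ∑-cong ps (λ p → linear ys (ff p) (fg p) (gf p) (gg p)) ⟩
    (∑ ps λ p → ∑ ys (ff p) + s * (∑ ys (fg p) + ∑ ys (gf p)) + s * s * ∑ ys (gg p))
      ≡⟨ linear ps (λ p → ∑ ys (ff p)) (λ p → ∑ ys (fg p)) (λ p → ∑ ys (gf p)) (λ p → ∑ ys (gg p)) ⟩
    form f f + s * (form f g + form g f) + s * s * form g g
      ∎
    where
    open ≡-Reasoning
    ps = allPoints d n
    ys = allDirections d
    ff fg gf gg : Point d n → Direction d → ℤ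
    ff p y = f p * f (p ⊕ y)
    fg p y = f p * g (p ⊕ y)
    gf p y = g p * f (p ⊕ y)
    gg p y = g p * g (p ⊕ y)
    expand : ∀ a b a′ b′ s → (a + s * b) * (a′ + s * b′) ≡ a * a′ + s * (a * b′ + b * a′) + s * s * (b * b′)
    expand = solve-∀
    linear : ∀ {A : Set} (xs : List A) (h₁ h₂ h₃ h₄ : A → ℤ) →
      ∑ xs (λ x → h₁ x + s * (h₂ x + h₃ x) + s * s * h₄ x) ≡
      ∑ xs h₁ + s * (∑ xs h₂ + ∑ xs h₃) + s * s * ∑ xs h₄
    linear xs h₁ h₂ h₃ h₄ = trans (∑-+ xs _ _) (cong₂ _+_
      (trans (∑-+ xs _ _) (cong (_+_ (∑ xs h₁)) (trans (∑-* xs s _) (cong (s *_) (∑-+ xs h₂ h₃)))))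
      (∑-* xs (s * s) h₄))

  norm²-parallelogram : ∀ {d} (f g : Point d n → ℤ) →
    norm² (f ⟨ 1ℤ ⟩ g) + norm² (f ⟨ -1ℤ ⟩ g) ≡ + 2 * (norm² f + norm² g)
  norm²-parallelogram {d} f g = begin
    norm² (f ⟨ 1ℤ ⟩ g) + norm² (f ⟨ -1ℤ ⟩ g)
      ≡⟨ ∑-+ ps _ _ ⟨
    (∑ ps λ p → (f p + 1ℤ * g p) * (f p + 1ℤ * g p) + (f p + -1ℤ * g p) * (f p + -1ℤ * g p))
      ≡⟨ ∑-cong ps (λ p → expand (f p) (g p)) ⟩
    (∑ ps λ p → + 2 * (f p * f p + g p * g p))
      ≡⟨ trans (∑-* ps (+ 2) _) (cong (+ 2 *_) (∑-+ ps _ _)) ⟩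
    + 2 * (norm² f + norm² g)
      ∎
    where
    open ≡-Reasoning
    ps = allPoints d n
    expand : ∀ a b → (a + 1ℤ * b) * (a + 1ℤ * b) + (a + -1ℤ * b) * (a + -1ℤ * b) ≡ + 2 * (a * a + b * b)
    expand = solve-∀

  -- Directions are split by their first entry: `zer` pairs a slice with itself, `plus` with its
  -- successor, `minus` with its predecessor.
  form-slices : ∀ {d} (f : Point (suc d) n → ℤ) → form f f ≡
    ∑ (allFin n) (λ i → form (slice f i) (slice f i)) +
    ∑ (allFin n) (λ i → form (slice f i) (slice f (next i)) + form (slice f (next i)) (slice f i))
  form-slices {d} f = begin
    form f f
      ≡⟨ ∑-allVecs d is _ ⟩
    (∑ is λ i → ∑ ps λ v → ∑ (allDirections (suc d)) λ y → f (i ∷ v) * f ((i ∷ v) ⊕ y))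
      ≡⟨ ∑-cong is (λ i → ∑-cong ps λ v → ∑-allVecs d dirs _) ⟩
    (∑ is λ i → ∑ ps λ v → ∑ dirs λ e → ∑ (allDirections d) λ y → f (i ∷ v) * f (addDir i e ∷ (v ⊕ y)))
      ≡⟨ ∑-cong is (λ i → trans (∑-swap ps dirs _) (∑-dirs λ e → F i (addDir i e))) ⟩
    (∑ is λ i → F i (addDir i minus) + (F i i + F i (next i)))
      ≡⟨ trans (∑-+ is _ _) (cong (_+_ (∑ is λ i → F i (addDir i minus))) (∑-+ is _ _)) ⟩
    (∑ is λ i → F i (addDir i minus)) + ((∑ is λ i → F i i) + (∑ is λ i → F i (next i)))
      ≡⟨ cong (_+ ((∑ is λ i → F i i) + (∑ is λ i → F i (next i)))) reindex ⟩
    (∑ is λ i → F (next i) i) + ((∑ is λ i → F i i) + (∑ is λ i → F i (next i)))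
      ≡⟨ rearrange (∑ is λ i → F (next i) i) (∑ is λ i → F i i) (∑ is λ i → F i (next i)) ⟩
    (∑ is λ i → F i i) + ((∑ is λ i → F i (next i)) + (∑ is λ i → F (next i) i))
      ≡⟨ cong (_+_ (∑ is λ i → F i i)) (∑-+ is _ _) ⟨
    (∑ is λ i → F i i) + (∑ is λ i → F i (next i) + F (next i) i)
      ∎
    where
    open ≡-Reasoning
    is = allFin n
    ps = allPoints d n
    dirs = minus ∷ zer ∷ plus ∷ []
    F : Fin n → Fin n → ℤ
    F i j = form (slice f i) (slice f j)
    -- Moving the index one step turns the pairs (i, i - 1) into (i + 1, i).
    reindex : ∑ is (λ i → F i (addDir i minus)) ≡ ∑ is (λ i → F (next i) i)
    reindex = trans (sym (∑-addDir plus λ i → F i (addDir i minus)))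
      (∑-cong is λ i → cong (F (next i)) (addDir-neg plus i))
    rearrange : ∀ a b c → a + (b + c) ≡ b + (c + a)
    rearrange = solve-∀

  pencil : ∀ {d} → ℤ → (Point (suc d) n → ℤ) → Fin n → Point d n → ℤ
  pencil s f i = slice f i ⟨ s ⟩ slice f (next i)

  -- With S the diagonal and M the neighbouring terms, B(f,f) = S + M, the pencils for s = ±1 total
  -- 2S ± M, and 3(2S + M) - (2S - M) = 4(S + M).
  form-split : ∀ {d} (f : Point (suc d) n → ℤ) → + 4 * form f f ≡
    + 3 * ∑ (allFin n) (λ i → form (pencil 1ℤ f i) (pencil 1ℤ f i)) -
    ∑ (allFin n) (λ i → form (pencil -1ℤ f i) (pencil -1ℤ f i))
  form-split {d} f = trans (cong (+ 4 *_) (form-slices f)) (trans (combine S M)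
    (sym (cong₂ (λ a b → + 3 * a - b) (total 1ℤ) (total -1ℤ))))
    where
    is = allFin n
    S = ∑ is λ i → form (slice f i) (slice f i)
    M = ∑ is λ i → form (slice f i) (slice f (next i)) + form (slice f (next i)) (slice f i)
    total : ∀ s → ∑ is (λ i → form (pencil s f i) (pencil s f i)) ≡ S + s * M + s * s * S
    total s = trans (∑-cong is λ i → form-pencil s (slice f i) (slice f (next i))) (trans (∑-+ is _ _) (cong₂ _+_
      (trans (∑-+ is _ _) (cong (_+_ S) (∑-* is s _)))
      (trans (∑-* is (s * s) _) (cong (s * s *_) (∑-addDir plus λ i → form (slice f i) (slice f i))))))
    combine : ∀ a b → + 4 * (a + b) ≡ + 3 * (a + 1ℤ * b + 1ℤ * 1ℤ * a) - (a + -1ℤ * b + -1ℤ * -1ℤ * a)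
    combine = solve-∀

  norm²-split : ∀ {d} (f : Point (suc d) n → ℤ) → + 4 * norm² f ≡
    ∑ (allFin n) (λ i → norm² (pencil 1ℤ f i)) + ∑ (allFin n) (λ i → norm² (pencil -1ℤ f i))
  norm²-split {d} f = begin
    + 4 * norm² f
      ≡⟨ cong (+ 4 *_) (∑-allVecs d is _) ⟩
    + 4 * S
      ≡⟨ double S ⟩
    + 2 * (S + S)
      ≡⟨ cong (λ t → + 2 * (S + t)) (∑-addDir plus λ i → norm² (slice f i)) ⟨
    + 2 * (S + ∑ is λ i → norm² (slice f (next i)))
      ≡⟨ trans (∑-* is (+ 2) _) (cong (+ 2 *_) (∑-+ is _ _)) ⟨
    (∑ is λ i → + 2 * (norm² (slice f i) + norm² (slice f (next i))))
      ≡⟨ ∑-cong is (λ i → norm²-parallelogram (slice f i) (slice f (next i))) ⟨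
    (∑ is λ i → norm² (pencil 1ℤ f i) + norm² (pencil -1ℤ f i))
      ≡⟨ ∑-+ is _ _ ⟩
    ∑ is (λ i → norm² (pencil 1ℤ f i)) + ∑ is (λ i → norm² (pencil -1ℤ f i))
      ∎
    where
    open ≡-Reasoning
    is = allFin n
    S = ∑ is λ i → norm² (slice f i)
    double : ∀ a → + 4 * a ≡ + 2 * (a + a)
    double = solve-∀

  module _ {d} (f : Point (suc d) n → ℤ) where

    private
      is = allFin n
      c = + (3 ℕ.^ d)
      N⁺ = ∑ is λ i → norm² (pencil 1ℤ f i)
      N⁻ = ∑ is λ i → norm² (pencil -1ℤ f i)
      B⁺ = ∑ is λ i → form (pencil 1ℤ f i) (pencil 1ℤ f i)
      B⁻ = ∑ is λ i → form (pencil -1ℤ f i) (pencil -1ℤ f i)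

    ∑-lower : ∀ s → ∑ is (λ i → lower (pencil s f i)) ≡
      c * ∑ is (λ i → norm² (pencil s f i)) + + 3 * ∑ is (λ i → form (pencil s f i) (pencil s f i))
    ∑-lower s = trans (∑-+ is _ _) (cong₂ _+_ (∑-* is c _) (∑-* is (+ 3) _))

    ∑-upper : ∀ s → ∑ is (λ i → upper (pencil s f i)) ≡
      c * ∑ is (λ i → norm² (pencil s f i)) + -1ℤ * ∑ is (λ i → form (pencil s f i) (pencil s f i))
    ∑-upper s = trans (∑-+ is _ _) (cong₂ _+_ (∑-* is c _)
      (trans (∑-cong is λ i → sym (-1*i≡-i (form (pencil s f i) (pencil s f i)))) (∑-* is -1ℤ _)))

    -- In `form-split` the differences enter with a minus sign, so the lower bound in dimension d +
    -- 1 calls for the lower bound on sums but the upper bound on differences.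
    lower-split : + 4 * lower f ≡
      + 3 * (∑ is (λ i → lower (pencil 1ℤ f i)) + ∑ is (λ i → upper (pencil -1ℤ f i)))
    lower-split = begin
      + 4 * lower f                                                    ≡⟨ cong (λ t → + 4 * (t * norm² f + + 3 * form f f)) (pos-* 3 (3 ℕ.^ d)) ⟩
      + 4 * (+ 3 * c * norm² f + + 3 * form f f)                       ≡⟨ regroup c (norm² f) (form f f) ⟩
      + 3 * c * (+ 4 * norm² f) + + 3 * (+ 4 * form f f)               ≡⟨ cong₂ (λ a b → + 3 * c * a + + 3 * b) (norm²-split f) (form-split f) ⟩
      + 3 * c * (N⁺ + N⁻) + + 3 * (+ 3 * B⁺ - B⁻)                      ≡⟨ combine c N⁺ N⁻ B⁺ B⁻ ⟩
      + 3 * ((c * N⁺ + + 3 * B⁺) + (c * N⁻ + -1ℤ * B⁻))                ≡⟨ cong₂ (λ a b → + 3 * (a + b)) (∑-lower 1ℤ) (∑-upper -1ℤ) ⟨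
      + 3 * (∑ is (λ i → lower (pencil 1ℤ f i)) + ∑ is (λ i → upper (pencil -1ℤ f i))) ∎
      where
      open ≡-Reasoning
      regroup : ∀ c a b → + 4 * (+ 3 * c * a + + 3 * b) ≡ + 3 * c * (+ 4 * a) + + 3 * (+ 4 * b)
      regroup = solve-∀
      combine : ∀ c a a′ b b′ → + 3 * c * (a + a′) + + 3 * (+ 3 * b - b′) ≡ + 3 * ((c * a + + 3 * b) + (c * a′ + -1ℤ * b′))
      combine = solve-∀

    -- Here the differences contribute 9c N⁻ + 3 B⁻, of which the lower bound consumes only c N⁻ + 3
    -- B⁻. The surplus 8c N⁻ is what makes the differences vanish in the equality case.
    upper-split : + 12 * upper f ≡
      + 9 * ∑ is (λ i → upper (pencil 1ℤ f i)) +
      (∑ is (λ i → lower (pencil -1ℤ f i)) + + 8 * (c * N⁻))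
    upper-split = begin
      + 12 * upper f                                                   ≡⟨ cong (λ t → + 12 * (t * norm² f - form f f)) (pos-* 3 (3 ℕ.^ d)) ⟩
      + 12 * (+ 3 * c * norm² f - form f f)                            ≡⟨ regroup c (norm² f) (form f f) ⟩
      + 9 * c * (+ 4 * norm² f) - + 3 * (+ 4 * form f f)               ≡⟨ cong₂ (λ a b → + 9 * c * a - + 3 * b) (norm²-split f) (form-split f) ⟩
      + 9 * c * (N⁺ + N⁻) - + 3 * (+ 3 * B⁺ - B⁻)                      ≡⟨ combine c N⁺ N⁻ B⁺ B⁻ ⟩
      + 9 * (c * N⁺ + -1ℤ * B⁺) + ((c * N⁻ + + 3 * B⁻) + + 8 * (c * N⁻)) ≡⟨ cong₂ (λ a b → + 9 * a + (b + + 8 * (c * N⁻))) (∑-upper 1ℤ) (∑-lower -1ℤ) ⟨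
      + 9 * ∑ is (λ i → upper (pencil 1ℤ f i)) + (∑ is (λ i → lower (pencil -1ℤ f i)) + + 8 * (c * N⁻)) ∎
      where
      open ≡-Reasoning
      regroup : ∀ c a b → + 12 * (+ 3 * c * a - b) ≡ + 9 * c * (+ 4 * a) - + 3 * (+ 4 * b)
      regroup = solve-∀
      combine : ∀ c a a′ b b′ → + 9 * c * (a + a′) - + 3 * (+ 3 * b - b′) ≡
        + 9 * (c * a + -1ℤ * b) + ((c * a′ + + 3 * b′) + + 8 * (c * a′))
      combine = solve-∀

3^d*i≡0⇒i≡0 : ∀ d {i} → + (3 ℕ.^ d) * i ≡ 0ℤ → i ≡ 0ℤ
3^d*i≡0⇒i≡0 d {i} eq with i*j≡0⇒i≡0∨j≡0 (+ (3 ℕ.^ d)) eq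
... | inj₁ 3^d≡0 = contradiction (sym (+-injective 3^d≡0)) (ℕ.<⇒≢ (ℕ.m^n>0 3 d))
... | inj₂ i≡0   = i≡0

a-b≡0⇒a≡b : ∀ a b → a + -1ℤ * b ≡ 0ℤ → a ≡ b
a-b≡0⇒a≡b a b eq = i-j≡0⇒i≡j a b (trans (cong (_+_ a) (sym (-1*i≡-i b))) eq)

IsSign : ℤ → Set
IsSign i = i ≡ 1ℤ ⊎ i ≡ -1ℤ

-- Distinct signs differ by 2 or -2, and each of these values comes from only one ordered pair of
-- signs.
sign-difference : ∀ {a b a′ b′} → IsSign a → IsSign b → IsSign a′ → IsSign b′ →
  a ≢ b → a + -1ℤ * b ≡ a′ + -1ℤ * b′ → a ≡ a′
sign-difference (inj₁ refl) (inj₁ refl) _ _ a≢b _ = contradiction refl a≢b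
sign-difference (inj₂ refl) (inj₂ refl) _ _ a≢b _ = contradiction refl a≢b
sign-difference (inj₁ refl) (inj₂ refl) (inj₁ refl) _ _ _ = refl
sign-difference (inj₁ refl) (inj₂ refl) (inj₂ refl) (inj₁ refl) _ ()
sign-difference (inj₁ refl) (inj₂ refl) (inj₂ refl) (inj₂ refl) _ ()
sign-difference (inj₂ refl) (inj₁ refl) (inj₂ refl) _ _ _ = refl
sign-difference (inj₂ refl) (inj₁ refl) (inj₁ refl) (inj₁ refl) _ ()
sign-difference (inj₂ refl) (inj₁ refl) (inj₁ refl) (inj₂ refl) _ ()

sign≢0 : ∀ {i} → IsSign i → i ≢ 0ℤ
sign≢0 (inj₁ refl) ()
sign≢0 (inj₂ refl) ()

-- Bounds on the quadratic form and their equality cases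

module _ {m : ℕ} where

  private n = suc m

  norm²-nonneg : ∀ {d} (f : Point d n → ℤ) → 0ℤ ≤ norm² f
  norm²-nonneg {d} f = ∑-nonneg (allPoints d n) λ p → 0≤i*i (f p)

  norm²-zero : ∀ {d} (f : Point d n → ℤ) → norm² f ≡ 0ℤ → ∀ p → f p ≡ 0ℤ
  norm²-zero {d} f eq p =
    i*i≡0⇒i≡0 (f p) (∑-nonneg-zero (allPoints d n) (λ q → 0≤i*i (f q)) eq (∈-points p))

  norm²-zero-dim : (f : Point 0 n → ℤ) → norm² f ≡ f [] * f []
  norm²-zero-dim f = ∑-singleton [] _

  form-zero-dim : (f : Point 0 n → ℤ) → form f f ≡ f [] * f []
  form-zero-dim f = trans (∑-singleton [] _) (∑-singleton [] _)

  lower-zero-dim : (f : Point 0 n → ℤ) → lower f ≡ + 4 * (f [] * f [])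
  lower-zero-dim f = trans (cong₂ (λ a b → 1ℤ * a + + 3 * b) (norm²-zero-dim f) (form-zero-dim f)) (collect (f [] * f []))
    where
    collect : ∀ a → 1ℤ * a + + 3 * a ≡ + 4 * a
    collect = solve-∀

  upper-zero-dim : (f : Point 0 n → ℤ) → upper f ≡ 0ℤ
  upper-zero-dim f = trans (cong₂ (λ a b → 1ℤ * a - b) (norm²-zero-dim f) (form-zero-dim f)) (collect (f [] * f []))
    where
    collect : ∀ a → 1ℤ * a - a ≡ 0ℤ
    collect = solve-∀

  -- The two bounds are proved by mutual induction on d, because `lower-split` and `upper-split`
  -- each involve both defects in the dimension below.
  lower-nonneg : ∀ {d} (f : Point d n → ℤ) → 0ℤ ≤ lower f
  upper-nonneg : ∀ {d} (f : Point d n → ℤ) → 0ℤ ≤ upper f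

  lower-nonneg {zero}  f = subst (0ℤ ≤_) (sym (lower-zero-dim f)) (0≤*⁺ 4 (0≤i*i (f [])))
  lower-nonneg {suc d} f = *-cancelˡ-≤-pos 0ℤ (lower f) (+ 4) (subst (0ℤ ≤_) (sym (lower-split f))
    (0≤*⁺ 3 (+-mono-≤ (∑-nonneg (allFin n) λ i → lower-nonneg (pencil 1ℤ f i))
                      (∑-nonneg (allFin n) λ i → upper-nonneg (pencil -1ℤ f i)))))

  upper-nonneg {zero}  f = ≤-reflexive (sym (upper-zero-dim f))
  upper-nonneg {suc d} f = *-cancelˡ-≤-pos 0ℤ (upper f) (+ 12) (subst (0ℤ ≤_) (sym (upper-split f))
    (+-mono-≤ (0≤*⁺ 9 (∑-nonneg (allFin n) λ i → upper-nonneg (pencil 1ℤ f i)))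
    (+-mono-≤ (∑-nonneg (allFin n) λ i → lower-nonneg (pencil -1ℤ f i))
              (0≤*⁺ 8 (0≤*⁺ (3 ℕ.^ d) (∑-nonneg (allFin n) λ i → norm²-nonneg (pencil -1ℤ f i)))))))

  lower-zero-pencils : ∀ {d} (f : Point (suc d) n → ℤ) → lower f ≡ 0ℤ →
    ∀ i → lower (pencil 1ℤ f i) ≡ 0ℤ × upper (pencil -1ℤ f i) ≡ 0ℤ
  lower-zero-pencils f eq i =
    ∑-nonneg-zero (allFin n) 0≤L (+-nonneg-zeroˡ (∑-nonneg _ 0≤L) (∑-nonneg _ 0≤U) total) (∈-allFin i) ,
    ∑-nonneg-zero (allFin n) 0≤U (+-nonneg-zeroʳ (∑-nonneg _ 0≤L) (∑-nonneg _ 0≤U) total) (∈-allFin i)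
    where
    L U : Fin n → ℤ
    L i = lower (pencil 1ℤ f i)
    U i = upper (pencil -1ℤ f i)
    0≤L : ∀ i → 0ℤ ≤ L i
    0≤L i = lower-nonneg (pencil 1ℤ f i)
    0≤U : ∀ i → 0ℤ ≤ U i
    0≤U i = upper-nonneg (pencil -1ℤ f i)
    total : ∑ (allFin n) L + ∑ (allFin n) U ≡ 0ℤ
    total = *-cancelˡ-≡ (+ 3) _ 0ℤ (trans (sym (lower-split f)) (cong (+ 4 *_) eq))

  upper-zero-pencils : ∀ {d} (f : Point (suc d) n → ℤ) → upper f ≡ 0ℤ →
    ∀ i → upper (pencil 1ℤ f i) ≡ 0ℤ × (∀ v → pencil -1ℤ f i v ≡ 0ℤ)
  upper-zero-pencils {d} f eq i =
    ∑-nonneg-zero (allFin n) 0≤U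
      (*-cancelˡ-≡ (+ 9) _ 0ℤ (+-nonneg-zeroˡ (0≤*⁺ 9 (∑-nonneg _ 0≤U)) (+-mono-≤ (∑-nonneg _ 0≤L) 0≤8cN) total))
      (∈-allFin i) ,
    norm²-zero (pencil -1ℤ f i) (∑-nonneg-zero (allFin n) 0≤N
      (3^d*i≡0⇒i≡0 d (*-cancelˡ-≡ (+ 8) _ 0ℤ (+-nonneg-zeroʳ (∑-nonneg _ 0≤L) 0≤8cN
        (+-nonneg-zeroʳ (0≤*⁺ 9 (∑-nonneg _ 0≤U)) (+-mono-≤ (∑-nonneg _ 0≤L) 0≤8cN) total))))
      (∈-allFin i))
    where
    L U N : Fin n → ℤ
    L i = lower (pencil -1ℤ f i)
    U i = upper (pencil 1ℤ f i)
    N i = norm² (pencil -1ℤ f i)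
    0≤L : ∀ i → 0ℤ ≤ L i
    0≤L i = lower-nonneg (pencil -1ℤ f i)
    0≤U : ∀ i → 0ℤ ≤ U i
    0≤U i = upper-nonneg (pencil 1ℤ f i)
    0≤N : ∀ i → 0ℤ ≤ N i
    0≤N i = norm²-nonneg (pencil -1ℤ f i)
    0≤8cN : 0ℤ ≤ + 8 * (+ (3 ℕ.^ d) * ∑ (allFin n) N)
    0≤8cN = 0≤*⁺ 8 (0≤*⁺ (3 ℕ.^ d) (∑-nonneg _ 0≤N))
    total : + 9 * ∑ (allFin n) U + (∑ (allFin n) L + + 8 * (+ (3 ℕ.^ d) * ∑ (allFin n) N)) ≡ 0ℤ
    total = trans (sym (upper-split f)) (cong (+ 12 *_) eq)

  -- Consecutive slices agree, so f is constant along the first coordinate. The sum of two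
  -- consecutive slices is then twice a slice and attains the upper bound itself, so induction
  -- handles the other coordinates.
  upper-zero⇒constant : ∀ {d} (f : Point d n → ℤ) → upper f ≡ 0ℤ → ∀ p q → f p ≡ f q
  upper-zero⇒constant f eq []      []      = refl
  upper-zero⇒constant f eq (i ∷ v) (j ∷ w) = trans
    (cyclic-induction (λ k → f (i ∷ v) ≡ f (k ∷ v)) (λ k fi≡fk → trans fi≡fk (advance k v)) refl j)
    (*-cancelˡ-≡ (+ 2) _ _ (begin
      + 2 * f (j ∷ v)                    ≡⟨ double j v ⟩
      pencil 1ℤ f j v                    ≡⟨ upper-zero⇒constant (pencil 1ℤ f j) (proj₁ (upper-zero-pencils f eq j)) v w ⟩
      pencil 1ℤ f j w                    ≡⟨ double j w ⟨
      + 2 * f (j ∷ w)                    ∎))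
    where
    open ≡-Reasoning
    advance : ∀ k u → f (k ∷ u) ≡ f (next k ∷ u)
    advance k u = a-b≡0⇒a≡b (f (k ∷ u)) (f (next k ∷ u)) (proj₂ (upper-zero-pencils f eq k) u)
    two : ∀ a → + 2 * a ≡ a + 1ℤ * a
    two = solve-∀
    double : ∀ k u → + 2 * f (k ∷ u) ≡ pencil 1ℤ f k u
    double k u = trans (two (f (k ∷ u))) (cong (λ t → f (k ∷ u) + 1ℤ * t) (advance k u))

  -- For constant f the form equals 3ᵈ ‖f‖², so the lower defect is 4 · 3ᵈ ‖f‖².
  lower-constant-zero : ∀ {d} (f : Point d n → ℤ) → (∀ p q → f p ≡ f q) → lower f ≡ 0ℤ → ∀ p → f p ≡ 0ℤ
  lower-constant-zero {d} f const eq = norm²-zero f (3^d*i≡0⇒i≡0 d (*-cancelˡ-≡ (+ 4) _ 0ℤ (begin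
    + 4 * (c * norm² f)                    ≡⟨ collect (c * norm² f) ⟨
    c * norm² f + + 3 * (c * norm² f)      ≡⟨ cong (λ t → c * norm² f + + 3 * t) form≡ ⟨
    lower f                                ≡⟨ eq ⟩
    0ℤ                                     ∎)))
    where
    open ≡-Reasoning
    c = + (3 ℕ.^ d)
    collect : ∀ a → a + + 3 * a ≡ + 4 * a
    collect = solve-∀
    form≡ : form f f ≡ c * norm² f
    form≡ = trans (∑-cong (allPoints d n) λ p → trans
      (∑-cong (allDirections d) λ y → cong (f p *_) (const (p ⊕ y) p))
      (∑-allVecs-const d _ (f p * f p))) (∑-* (allPoints d n) c _)

  -- The defect is quadratic. This serves the case where consecutive slices agree and their sum is
  -- twice a slice.
  lower-double : ∀ {d} (f g : Point d n → ℤ) → (∀ p → g p ≡ + 2 * f p) → lower g ≡ + 4 * lower f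
  lower-double {d} f g g≡2f = trans
    (cong₂ (λ a b → + (3 ℕ.^ d) * a + + 3 * b)
      (trans (∑-cong ps λ p → quadruple p p) (∑-* ps (+ 4) _))
      (trans (∑-cong ps λ p → trans (∑-cong ys λ y → quadruple p (p ⊕ y)) (∑-* ys (+ 4) _)) (∑-* ps (+ 4) _)))
    (collect (+ (3 ℕ.^ d)) (norm² f) (form f f))
    where
    ps = allPoints d n
    ys = allDirections d
    expand : ∀ a b → (+ 2 * a) * (+ 2 * b) ≡ + 4 * (a * b)
    expand = solve-∀
    quadruple : ∀ p q → g p * g q ≡ + 4 * (f p * f q)
    quadruple p q = trans (cong₂ _*_ (g≡2f p) (g≡2f q)) (expand (f p) (f q))
    collect : ∀ c a b → c * (+ 4 * a) + + 3 * (+ 4 * b) ≡ + 4 * (c * a + + 3 * b)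
    collect = solve-∀

  Alternating : ∀ {d} → (Point d n → ℤ) → Set
  Alternating {d} f = Σ (Fin d) λ r → Σ (Fin n → ℤ) λ g →
    (∀ p → f p ≡ g (lookup p r)) × (∀ i → g (next i) ≡ - g i)

  -- The differences of consecutive slices are constant.  Either they all vanish, and f does not depend on the
  -- first coordinate, or one of them is ±2, which makes one slice, and hence every slice, constant.
  lower-zero⇒alternating : ∀ {d} (f : Point d n → ℤ) → (∀ p → IsSign (f p)) → lower f ≡ 0ℤ → Alternating f
  lower-zero⇒alternating {zero} f sign eq = contradiction
    (i*i≡0⇒i≡0 (f []) (*-cancelˡ-≡ (+ 4) _ 0ℤ (trans (sym (lower-zero-dim f)) eq))) (sign≢0 (sign []))
  -- Testing at one point suffices, since the difference of two consecutive slices is constant.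
  lower-zero⇒alternating {suc d} f sign eq with any? (λ i → ¬? (f (i ∷ replicate d zero) ≟ f (next i ∷ replicate d zero)))
  ... | yes (i , fi≢fi⁺) = zero , (λ j → f (j ∷ v₀)) , (λ { (j ∷ v) → constant j v }) , opposite
    where
    v₀ = replicate d zero
    difference : ∀ j v → pencil -1ℤ f j v ≡ pencil -1ℤ f j v₀
    difference j v = upper-zero⇒constant (pencil -1ℤ f j) (proj₂ (lower-zero-pencils f eq j)) v v₀
    solve-next : ∀ a b → b ≡ a - (a + -1ℤ * b)
    solve-next = solve-∀
    step : ∀ j → (∀ v → f (j ∷ v) ≡ f (j ∷ v₀)) → ∀ v → f (next j ∷ v) ≡ f (next j ∷ v₀)
    step j constⱼ v = trans (solve-next (f (j ∷ v)) (f (next j ∷ v)))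
      (trans (cong₂ _-_ (constⱼ v) (difference j v)) (sym (solve-next (f (j ∷ v₀)) (f (next j ∷ v₀)))))
    constant : ∀ j v → f (j ∷ v) ≡ f (j ∷ v₀)
    constant = cyclic-induction (λ j → ∀ v → f (j ∷ v) ≡ f (j ∷ v₀)) step {i} λ v →
      sym (sign-difference (sign _) (sign _) (sign _) (sign _) fi≢fi⁺ (sym (difference i v)))
    solve-opposite : ∀ a b → b ≡ (a + 1ℤ * b) - a
    solve-opposite = solve-∀
    -- The sum of two constant slices is constant and has zero lower defect, hence vanishes.
    opposite : ∀ j → f (next j ∷ v₀) ≡ - f (j ∷ v₀)
    opposite j = trans (solve-opposite (f (j ∷ v₀)) (f (next j ∷ v₀))) (trans (cong (_- f (j ∷ v₀))
      (lower-constant-zero (pencil 1ℤ f j)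
        (λ v w → cong₂ (λ a b → a + 1ℤ * b) (trans (constant j v) (sym (constant j w)))
                                            (trans (constant (next j) v) (sym (constant (next j) w))))
        (proj₁ (lower-zero-pencils f eq j)) v₀))
      (+-identityˡ (- f (j ∷ v₀))))
  ... | no ∄i = let r , g , f≡g , alt = lower-zero⇒alternating (slice f zero) (λ v → sign (zero ∷ v)) slice-zero in
                suc r , g , (λ { (j ∷ v) → trans (sym (independent j v)) (f≡g v) }) , alt
    where
    v₀ = replicate d zero
    advance₀ : ∀ j → f (j ∷ v₀) ≡ f (next j ∷ v₀)
    advance₀ j = decidable-stable (f (j ∷ v₀) ≟ f (next j ∷ v₀)) λ ne → ∄i (j , ne)
    cancel : ∀ a → a + -1ℤ * a ≡ 0ℤ
    cancel = solve-∀
    advance : ∀ j v → f (j ∷ v) ≡ f (next j ∷ v)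
    advance j v = a-b≡0⇒a≡b (f (j ∷ v)) (f (next j ∷ v)) (trans
      (upper-zero⇒constant (pencil -1ℤ f j) (proj₂ (lower-zero-pencils f eq j)) v v₀)
      (trans (cong (λ t → f (j ∷ v₀) + -1ℤ * t) (sym (advance₀ j))) (cancel (f (j ∷ v₀)))))
    independent : ∀ j v → f (zero ∷ v) ≡ f (j ∷ v)
    independent j v = cyclic-induction (λ k → f (zero ∷ v) ≡ f (k ∷ v)) (λ k eqₖ → trans eqₖ (advance k v)) refl j
    two : ∀ a → a + 1ℤ * a ≡ + 2 * a
    two = solve-∀
    -- The sum of slices 0 and 1 is twice slice 0, so its vanishing defect is four times that of the
    -- slice, to which the induction applies.
    slice-zero : lower (slice f zero) ≡ 0ℤ
    slice-zero = *-cancelˡ-≡ (+ 4) _ 0ℤ (trans (sym (lower-double (slice f zero) (pencil 1ℤ f zero) λ v →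
      trans (cong (λ t → f (zero ∷ v) + 1ℤ * t) (sym (advance zero v))) (two (f (zero ∷ v)))))
      (proj₁ (lower-zero-pencils f eq zero)))

-- Alternating functions attain the lower bound

∑-lookup : ∀ {d} (r : Fin (suc d)) (G : Dir → ℤ) →
  ∑ (allDirections (suc d)) (λ y → G (lookup y r)) ≡ + (3 ℕ.^ d) * (G minus + (G zer + G plus))
∑-lookup {d} zero G = begin
  ∑ (allDirections (suc d)) (λ y → G (lookup y zero))      ≡⟨ ∑-allVecs d dirs _ ⟩
  ∑ dirs (λ e → ∑ (allDirections d) (λ _ → G e))           ≡⟨ ∑-cong dirs (λ e → ∑-allVecs-const d dirs (G e)) ⟩
  ∑ dirs (λ e → + (3 ℕ.^ d) * G e)                         ≡⟨ ∑-* dirs (+ (3 ℕ.^ d)) G ⟩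
  + (3 ℕ.^ d) * ∑ dirs G                                   ≡⟨ cong (+ (3 ℕ.^ d) *_) (∑-dirs G) ⟩
  + (3 ℕ.^ d) * (G minus + (G zer + G plus))               ∎
  where
  open ≡-Reasoning
  dirs = minus ∷ zer ∷ plus ∷ []
∑-lookup {suc d} (suc r) G = begin
  ∑ (allDirections (suc (suc d))) (λ y → G (lookup y (suc r)))           ≡⟨ ∑-allVecs (suc d) dirs _ ⟩
  ∑ dirs (λ _ → ∑ (allDirections (suc d)) (λ y → G (lookup y r)))        ≡⟨ ∑-const dirs _ ⟩
  + 3 * ∑ (allDirections (suc d)) (λ y → G (lookup y r))                 ≡⟨ cong (+ 3 *_) (∑-lookup r G) ⟩
  + 3 * (+ (3 ℕ.^ d) * (G minus + (G zer + G plus)))                     ≡⟨ *-assoc (+ 3) (+ (3 ℕ.^ d)) _ ⟨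
  + 3 * + (3 ℕ.^ d) * (G minus + (G zer + G plus))                       ≡⟨ cong (_* (G minus + (G zer + G plus))) (pos-* 3 (3 ℕ.^ d)) ⟨
  + (3 ℕ.^ suc d) * (G minus + (G zer + G plus))                         ∎
  where
  open ≡-Reasoning
  dirs = minus ∷ zer ∷ plus ∷ []

-- Summing f over the neighbours of p gives 3ᵈ (-g + g - g), where g is taken at the alternating
-- coordinate of p; so f is an eigenfunction of the neighbour sum with eigenvalue -3ᵈ.
alternating⇒lower-zero : ∀ {m d} (f : Point (suc d) (suc m) → ℤ) → Alternating f → lower f ≡ 0ℤ
alternating⇒lower-zero {m} {d} f (r , g , f≡g , alt) =
  trans (cong₂ (λ a b → a * norm² f + + 3 * b) (pos-* 3 (3 ℕ.^ d)) form≡) (cancel c (norm² f))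
  where
  open ≡-Reasoning
  c = + (3 ℕ.^ d)
  ps = allPoints (suc d) (suc m)
  ys = allDirections (suc d)
  cancel : ∀ c a → + 3 * c * a + + 3 * (- c * a) ≡ 0ℤ
  cancel = solve-∀
  collect : ∀ c a → c * (- a + (a + - a)) ≡ - c * a
  collect = solve-∀
  commute : ∀ c a → a * (- c * a) ≡ - c * (a * a)
  commute = solve-∀
  prev : ∀ i → g (addDir i minus) ≡ - g i
  prev i = trans (sym (neg-involutive _)) (cong -_ (trans (sym (alt (addDir i minus))) (cong g (addDir-neg minus i))))
  neighbours : ∀ p → ∑ ys (λ y → f (p ⊕ y)) ≡ - c * f p
  neighbours p = begin
    ∑ ys (λ y → f (p ⊕ y))                                     ≡⟨ ∑-cong ys (λ y → trans (f≡g (p ⊕ y)) (cong g (lookup-zipWith addDir r p y))) ⟩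
    ∑ ys (λ y → g (addDir i (lookup y r)))                     ≡⟨ ∑-lookup r (λ e → g (addDir i e)) ⟩
    c * (g (addDir i minus) + (g i + g (next i)))              ≡⟨ cong₂ (λ a b → c * (a + (g i + b))) (prev i) (alt i) ⟩
    c * (- g i + (g i + - g i))                                ≡⟨ collect c (g i) ⟩
    - c * g i                                                  ≡⟨ cong (- c *_) (f≡g p) ⟨
    - c * f p                                                  ∎
    where i = lookup p r
  form≡ : form f f ≡ - c * norm² f
  form≡ = begin
    form f f                                      ≡⟨ ∑-cong ps (λ p → ∑-* ys (f p) _) ⟩
    ∑ ps (λ p → f p * ∑ ys (λ y → f (p ⊕ y)))     ≡⟨ ∑-cong ps (λ p → cong (f p *_) (neighbours p)) ⟩
    ∑ ps (λ p → f p * (- c * f p))                ≡⟨ ∑-cong ps (λ p → commute c (f p)) ⟩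
    ∑ ps (λ p → - c * (f p * f p))                ≡⟨ ∑-* ps (- c) _ ⟩
    - c * norm² f                                 ∎

-- Counting occurrences

-- Lets inequalities between letters be settled by evaluation.
∀-label? : {P : Label → Set} → (∀ ℓ → Dec (P ℓ)) → Dec (∀ ℓ → P ℓ)
∀-label? P? with P? C | P? A | P? T
... | yes c | yes a | yes t = yes λ { C → c ; A → a ; T → t }
... | no ¬c | _     | _     = no λ all → ¬c (all C)
... | _     | no ¬a | _     = no λ all → ¬a (all A)
... | _     | _     | no ¬t = no λ all → ¬t (all T)

cat : Label → Label → Label → ℤ
cat a b c = + (if isC a ∧ isA b ∧ isT c then 1 else 0)

sgn : Label → ℤ
sgn C = -1ℤ
sgn A = 1ℤ
sgn T = -1ℤ

-- Four times the indicator of (b, c) being an edge from A to a letter other than A.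
cut : Label → Label → ℤ
cut b c = (1ℤ + sgn b) * (1ℤ - sgn c)

opaque

  gap : Label → Label → Label → ℤ
  gap a b c = cut b c + - + 4 * (cat a b c + cat c b a)

  gap≡ : ∀ a b c → gap a b c ≡ cut b c + - + 4 * (cat a b c + cat c b a)
  gap≡ a b c = refl

  gap-nonneg : ∀ a b c → 0ℤ ≤ gap a b c
  gap-nonneg = toWitness {a? = ∀-label? λ a → ∀-label? λ b → ∀-label? λ c → 0ℤ ≤? gap a b c} _

sgn-isSign : ∀ ℓ → IsSign (sgn ℓ)
sgn-isSign C = inj₂ refl
sgn-isSign A = inj₁ refl
sgn-isSign T = inj₂ refl

sgn-square : ∀ ℓ → sgn ℓ * sgn ℓ ≡ 1ℤ
sgn-square C = refl
sgn-square A = refl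
sgn-square T = refl

cat-diagonal : ∀ ℓ → cat ℓ ℓ ℓ ≡ 0ℤ
cat-diagonal C = refl
cat-diagonal A = refl
cat-diagonal T = refl

module _ {m : ℕ} where

  private n = suc m

  ⊕-zero : ∀ {d} (p : Point d n) y → nonzero y ≡ false → p ⊕ y ≡ p
  ⊕-zero []      []        _  = refl
  ⊕-zero (i ∷ p) (zer ∷ y) eq = cong (i ∷_) (⊕-zero p y eq)

  catIndicator≡cat : ∀ {d} (L : Labeling d n) x y →
    + catIndicator L x y ≡ cat (L x) (L (x ⊕ y)) (L ((x ⊕ y) ⊕ y))
  catIndicator≡cat L x y with nonzero y in eq
  ... | true  = refl
  ... | false rewrite ⊕-zero x y eq | ⊕-zero x y eq = sym (cat-diagonal (L x))

  module _ {d} (L : Labeling d n) where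

    private
      ps = allPoints d n
      ys = allDirections d
      f : Point d n → ℤ
      f p = sgn (L p)

    slack : ℤ
    slack = ∑ ps λ p → ∑ ys λ y → gap (L (p ⊕ negate y)) (L p) (L (p ⊕ y))

    -- For each fixed y, the translation p = x + y moves the base point from the letter C to the A
    -- in the middle.
    occurrences-centred : + occurrences L ≡ ∑ ps λ p → ∑ ys λ y → cat (L (p ⊕ negate y)) (L p) (L (p ⊕ y))
    occurrences-centred = begin
      + occurrences L
        ≡⟨ trans (pos-sum ps _) (∑-cong ps λ x → trans (pos-sum ys _) (∑-cong ys (catIndicator≡cat L x))) ⟩
      (∑ ps λ x → ∑ ys λ y → cat (L x) (L (x ⊕ y)) (L ((x ⊕ y) ⊕ y)))
        ≡⟨ ∑-cong ps (λ x → ∑-cong ys λ y → cong (λ t → cat (L t) (L (x ⊕ y)) (L ((x ⊕ y) ⊕ y))) (⊕-negate x y)) ⟨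
      (∑ ps λ x → ∑ ys λ y → F y (x ⊕ y))
        ≡⟨ ∑-swap ps ys _ ⟩
      (∑ ys λ y → ∑ ps λ x → F y (x ⊕ y))
        ≡⟨ ∑-cong ys (λ y → ∑-translate y (F y)) ⟩
      (∑ ys λ y → ∑ ps (F y))
        ≡⟨ ∑-swap ps ys (λ p y → F y p) ⟨
      (∑ ps λ p → ∑ ys λ y → F y p)
        ∎
      where
      open ≡-Reasoning
      F : Direction d → Point d n → ℤ
      F y p = cat (L (p ⊕ negate y)) (L p) (L (p ⊕ y))

    -- Exchanging y and -y counts every occurrence from the other side of its centre, which accounts
    -- for the second edge it uses.
    occurrences-reversed : + occurrences L ≡ ∑ ps λ p → ∑ ys λ y → cat (L (p ⊕ y)) (L p) (L (p ⊕ negate y))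
    occurrences-reversed = trans occurrences-centred (∑-cong ps λ p → trans
      (sym (∑-negate λ y → cat (L (p ⊕ negate y)) (L p) (L (p ⊕ y))))
      (∑-cong ys λ y → cong (λ t → cat (L (p ⊕ t)) (L p) (L (p ⊕ negate y))) (negate-involutive y)))

    -- In (1 + a)(1 - b) = 1 + a - b - ab the linear terms cancel after summation, because
    -- translation by y preserves the sum of f.
    ∑-cut : (∑ ps λ p → ∑ ys λ y → cut (L p) (L (p ⊕ y))) ≡ + (3 ℕ.^ d) * + (n ℕ.^ d) + -1ℤ * form f f
    ∑-cut = begin
      (∑ ps λ p → ∑ ys λ y → cut (L p) (L (p ⊕ y)))
        ≡⟨ ∑-cong ps (λ p → ∑-cong ys λ y → expand (f p) (f (p ⊕ y))) ⟩
      (∑ ps λ p → ∑ ys λ y → (1ℤ + f p) + -1ℤ * (f (p ⊕ y) + f p * f (p ⊕ y)))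
        ≡⟨ ∑-cong ps (λ p → trans (∑-+ ys _ _) (cong₂ _+_ (∑-allVecs-const d _ (1ℤ + f p))
             (trans (∑-* ys -1ℤ _) (cong (-1ℤ *_) (∑-+ ys _ _))))) ⟩
      (∑ ps λ p → c * (1ℤ + f p) + -1ℤ * (∑ ys (λ y → f (p ⊕ y)) + ∑ ys (λ y → f p * f (p ⊕ y))))
        ≡⟨ trans (∑-+ ps _ _) (cong₂ _+_ (trans (∑-* ps c _) (cong (c *_) (∑-+ ps _ _)))
             (trans (∑-* ps -1ℤ _) (cong (-1ℤ *_) (∑-+ ps _ _)))) ⟩
      c * (∑ ps (λ _ → 1ℤ) + ∑ ps f) + -1ℤ * ((∑ ps λ p → ∑ ys λ y → f (p ⊕ y)) + form f f)
        ≡⟨ cong₂ (λ a b → c * (a + ∑ ps f) + -1ℤ * (b + form f f)) (∑-points-const d n 1ℤ) ∑-neighbours ⟩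
      c * (+ (n ℕ.^ d) * 1ℤ + ∑ ps f) + -1ℤ * (c * ∑ ps f + form f f)
        ≡⟨ collect c (+ (n ℕ.^ d)) (∑ ps f) (form f f) ⟩
      c * + (n ℕ.^ d) + -1ℤ * form f f
        ∎
      where
      open ≡-Reasoning
      c = + (3 ℕ.^ d)
      expand : ∀ a b → (1ℤ + a) * (1ℤ - b) ≡ (1ℤ + a) + -1ℤ * (b + a * b)
      expand = solve-∀
      collect : ∀ c k a b → c * (k * 1ℤ + a) + -1ℤ * (c * a + b) ≡ c * k + -1ℤ * b
      collect = solve-∀
      ∑-neighbours : (∑ ps λ p → ∑ ys λ y → f (p ⊕ y)) ≡ c * ∑ ps f
      ∑-neighbours = trans (∑-swap ps ys _) (trans (∑-cong ys λ y → ∑-translate y f) (∑-allVecs-const d _ (∑ ps f)))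

    slack≡ : slack ≡ + (3 ℕ.^ d) * + (n ℕ.^ d) + -1ℤ * form f f + - + 4 * (+ occurrences L + + occurrences L)
    slack≡ = begin
      slack
        ≡⟨ ∑-cong ps (λ p → trans (∑-cong ys λ y → gap≡ (L (p ⊕ negate y)) (L p) (L (p ⊕ y))) (trans (∑-+ ys _ _) (cong (_+_ (∑ ys λ y → cut (L p) (L (p ⊕ y)))) (trans (∑-* ys (- + 4) (λ y → centred p y + reversed p y)) (cong (- + 4 *_) (∑-+ ys (centred p) (reversed p))))))) ⟩
      (∑ ps λ p → ∑ ys (λ y → cut (L p) (L (p ⊕ y))) + - + 4 *
        (∑ ys (centred p) + ∑ ys (reversed p)))
        ≡⟨ trans (∑-+ ps _ _) (cong₂ _+_ ∑-cut (trans (∑-* ps (- + 4) _) (cong (- + 4 *_) (trans (∑-+ ps _ _)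
             (cong₂ _+_ (sym occurrences-centred) (sym occurrences-reversed)))))) ⟩
      + (3 ℕ.^ d) * + (n ℕ.^ d) + -1ℤ * form f f + - + 4 * (+ occurrences L + + occurrences L)
        ∎
      where
      open ≡-Reasoning
      centred reversed : Point d n → Direction d → ℤ
      centred  p y = cat (L (p ⊕ negate y)) (L p) (L (p ⊕ y))
      reversed p y = cat (L (p ⊕ y)) (L p) (L (p ⊕ negate y))

    norm²-sgn : norm² f ≡ + (n ℕ.^ d)
    norm²-sgn = trans (∑-cong ps λ p → sgn-square (L p)) (trans (∑-points-const d n 1ℤ) (*-identityʳ _))

    -- The form has coefficient -1 in `slack` and 3 in `lower`, so it drops out of 3 · `slack` +
    -- `lower`. As both defects are nonnegative, this one identity yields the bound and its equality
    -- case.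
    count : + 24 * + occurrences L + (+ 3 * slack + lower f) ≡ + 4 * (+ (3 ℕ.^ d) * + (n ℕ.^ d))
    count = trans (cong₂ (λ a b → + 24 * o + (+ 3 * a + (+ (3 ℕ.^ d) * b + + 3 * form f f))) slack≡ norm²-sgn)
      (collect (+ (3 ℕ.^ d)) (+ (n ℕ.^ d)) (form f f) o)
      where
      o = + occurrences L
      collect : ∀ c k b o → + 24 * o + (+ 3 * (c * k + -1ℤ * b + - + 4 * (o + o)) + (c * k + + 3 * b)) ≡ + 4 * (c * k)
      collect = solve-∀

    slack-nonneg : 0ℤ ≤ slack
    slack-nonneg = ∑-nonneg ps λ p → ∑-nonneg ys λ y → gap-nonneg (L (p ⊕ negate y)) (L p) (L (p ⊕ y))

    -- No edge is wasted: whenever p carries A and p + y does not, the letters at p - y, p, p + y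
    -- spell CAT in one sense or the other.
    Tight : Set
    Tight = ∀ p y → gap (L (p ⊕ negate y)) (L p) (L (p ⊕ y)) ≡ 0ℤ

    slack-zero⇒tight : slack ≡ 0ℤ → Tight
    slack-zero⇒tight eq p y = ∑-nonneg-zero ys (λ y → gap-nonneg (L (p ⊕ negate y)) (L p) (L (p ⊕ y)))
      (∑-nonneg-zero ps (λ p → ∑-nonneg ys λ y → gap-nonneg (L (p ⊕ negate y)) (L p) (L (p ⊕ y))) eq (∈-points p))
      (∈-directions y)

    tight⇒slack-zero : Tight → slack ≡ 0ℤ
    tight⇒slack-zero tight = trans (∑-cong ps λ p → trans (∑-cong ys (tight p))
      (trans (∑-const ys 0ℤ) (*-zeroʳ (+ length ys)))) (trans (∑-const ps 0ℤ) (*-zeroʳ (+ length ps)))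

  module _ {d} (L : Labeling (suc d) n) where

    private
      f : Point (suc d) n → ℤ
      f p = sgn (L p)
      bound = 3 ℕ.^ d ℕ.* n ℕ.^ suc d

    deficit : + 12 * + (2 ℕ.* occurrences L) + (+ 3 * slack L + lower f) ≡ + 12 * + bound
    deficit = trans (cong (_+ (+ 3 * slack L + lower f)) left) (trans (count L) right)
      where
      twelve : ∀ a → + 12 * (+ 2 * a) ≡ + 24 * a
      twelve = solve-∀
      left : + 12 * + (2 ℕ.* occurrences L) ≡ + 24 * + occurrences L
      left = trans (cong (+ 12 *_) (pos-* 2 (occurrences L))) (twelve (+ occurrences L))
      collect : ∀ a b → + 4 * (+ 3 * a * b) ≡ + 12 * (a * b)
      collect = solve-∀
      right : + 4 * (+ (3 ℕ.^ suc d) * + (n ℕ.^ suc d)) ≡ + 12 * + bound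
      right = trans (cong (λ t → + 4 * (t * + (n ℕ.^ suc d))) (pos-* 3 (3 ℕ.^ d)))
        (trans (collect (+ (3 ℕ.^ d)) (+ (n ℕ.^ suc d))) (cong (+ 12 *_) (sym (pos-* (3 ℕ.^ d) (n ℕ.^ suc d)))))

    occurrences-bound : 2 ℕ.* occurrences L ℕ.≤ bound
    occurrences-bound = drop‿+≤+ (*-cancelˡ-≤-pos _ _ (+ 12) (subst (+ 12 * + (2 ℕ.* occurrences L) ≤_) deficit
      (≤-trans (≤-reflexive (sym (+-identityʳ _)))
        (+-monoʳ-≤ (+ 12 * + (2 ℕ.* occurrences L)) (+-mono-≤ (0≤*⁺ 3 (slack-nonneg L)) (lower-nonneg f))))))

    equality⇒extremal : 2 ℕ.* occurrences L ≡ bound → Tight L × Alternating f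
    equality⇒extremal eq =
      slack-zero⇒tight L (*-cancelˡ-≡ (+ 3) _ 0ℤ (+-nonneg-zeroˡ (0≤*⁺ 3 (slack-nonneg L)) (lower-nonneg f) rest≡0)) ,
      lower-zero⇒alternating f (λ p → sgn-isSign (L p)) (+-nonneg-zeroʳ (0≤*⁺ 3 (slack-nonneg L)) (lower-nonneg f) rest≡0)
      where
      rest≡0 : + 3 * slack L + lower f ≡ 0ℤ
      rest≡0 = +-cancelˡ-≡ (+ 12 * + bound) _ _ (trans (cong (λ t → + 12 * + t + (+ 3 * slack L + lower f)) (sym eq))
        (trans deficit (sym (+-identityʳ _))))

    extremal⇒equality : Tight L → Alternating f → 2 ℕ.* occurrences L ≡ bound
    extremal⇒equality tight alt = +-injective (*-cancelˡ-≡ (+ 12) _ _ (trans (sym (trans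
      (cong₂ (λ a b → + 12 * + (2 ℕ.* occurrences L) + (+ 3 * a + b)) (tight⇒slack-zero L tight) (alternating⇒lower-zero f alt))
      (+-identityʳ _))) deficit))

-- The labels of an extremal labeling

flip : Label → Label
flip C = T
flip A = A
flip T = C

flip-involutive : ∀ ℓ → flip (flip ℓ) ≡ ℓ
flip-involutive C = refl
flip-involutive A = refl
flip-involutive T = refl

opaque

  unfolding gap

  -- If b is not A, both ends are A, which `flip` fixes. If b is A, neither end is, the edge has
  -- weight 4, and only CAT or its reversal can absorb it.
  gap-zero⇒flip : ∀ a b c → sgn b ≡ - sgn a → sgn c ≡ - sgn b → gap a b c ≡ 0ℤ → c ≡ flip a
  gap-zero⇒flip A C A _  _  _  = refl
  gap-zero⇒flip A T A _  _  _  = refl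
  gap-zero⇒flip C A T _  _  _  = refl
  gap-zero⇒flip T A C _  _  _  = refl
  gap-zero⇒flip C A C _  _  ()
  gap-zero⇒flip T A T _  _  ()
  gap-zero⇒flip C A A _  () _
  gap-zero⇒flip T A A _  () _
  gap-zero⇒flip A C C _  () _
  gap-zero⇒flip A C T _  () _
  gap-zero⇒flip A T C _  () _
  gap-zero⇒flip A T T _  () _
  gap-zero⇒flip A A _ () _  _
  gap-zero⇒flip C C _ () _  _
  gap-zero⇒flip C T _ () _  _
  gap-zero⇒flip T C _ () _  _
  gap-zero⇒flip T T _ () _  _

sgn≡1⇒A : ∀ {ℓ} → sgn ℓ ≡ 1ℤ → ℓ ≡ A
sgn≡1⇒A {A} _ = refl

periodic : {X : Set} (F : ℕ → X) (c : ℕ) .{{_ : NonZero c}} → (∀ k → F (c ℕ.+ k) ≡ F k) → ∀ k → F k ≡ F (k % c)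
periodic F c per k = trans (cong F (trans (m≡m%n+[m/n]*n k c) (ℕ.+-comm (k % c) _))) (multiple (k / c) (k % c))
  where
  multiple : ∀ q j → F (q ℕ.* c ℕ.+ j) ≡ F j
  multiple zero    j = refl
  multiple (suc q) j = trans (cong F (ℕ.+-assoc c (q ℕ.* c) j)) (trans (per (q ℕ.* c ℕ.+ j)) (multiple q j))

-- The part of `psLabel` that depends only on the height s and one choice e, and hence on s modulo
-- 4.
psLetter : ℕ → Eps → Label
psLetter s e = if s % 2 ≡ᵇ 0 then A else if s % 4 ≡ᵇ epsVal e then C else T

psLetter-cong : ∀ s t e → s % 4 ≡ t % 4 → psLetter s e ≡ psLetter t e
psLetter-cong s t e eq = cong₂ (λ a b → if a ≡ᵇ 0 then A else if b ≡ᵇ epsVal e then C else T)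
  (trans (sym (m∣n⇒o%n%m≡o%m 2 4 s (divides 2 refl))) (trans (cong (_% 2) eq) (m∣n⇒o%n%m≡o%m 2 4 t (divides 2 refl)))) eq

-- Recovers the residue of C from the letter at height 1. The value at `A` is a default: the letters
-- passed in differ from `A` by `h1≢A`.
epsOf : Label → Eps
epsOf C = one
epsOf A = three
epsOf T = three

psLetter-epsOf : ∀ ℓ → ℓ ≢ A → psLetter 1 (epsOf ℓ) ≡ ℓ × psLetter 3 (epsOf ℓ) ≡ flip ℓ
psLetter-epsOf C _   = refl , refl
psLetter-epsOf A ℓ≢A = contradiction refl ℓ≢A
psLetter-epsOf T _   = refl , refl

flip-fixed⇒A : ∀ {ℓ} → flip ℓ ≡ ℓ → ℓ ≡ A
flip-fixed⇒A {A} _ = refl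

map-removeAt : ∀ {X Y : Set} (f : X → Y) {k} (xs : Vec X (suc k)) r → Vec.map f (removeAt xs r) ≡ removeAt (Vec.map f xs) r
map-removeAt f (x ∷ xs)         zero    = refl
map-removeAt f (x ∷ xs@(_ ∷ _)) (suc r) = cong (f x ∷_) (map-removeAt f xs r)

module _ {m : ℕ} where

  private n = suc m

  ⊕-replicate-zer : ∀ {d} (p : Point d n) → p ⊕ replicate d zer ≡ p
  ⊕-replicate-zer []      = refl
  ⊕-replicate-zer (i ∷ p) = cong (i ∷_) (⊕-replicate-zer p)

  insertAt-⊕ : ∀ {d} (w : Point d n) v r s e → insertAt w r s ⊕ insertAt v r e ≡ insertAt (w ⊕ v) r (addDir s e)
  insertAt-⊕ w       v       zero    s e = refl
  insertAt-⊕ (i ∷ w) (k ∷ v) (suc r) s e = cong (addDir i k ∷_) (insertAt-⊕ w v r s e)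

  -- The representative, i₀ or its successor, of the parity class of t counted from i₀.
  canonical : Fin n → Fin n → Fin n
  canonical i₀ t = shift i₀ (toℕ (toℕ (subFin t i₀) mod 2))

  -- Coordinates are normalised one at a time: a direction with a single nonzero entry gives period
  -- 2 in that coordinate.
  even-periodic : ∀ {d} {X : Set} (i₀ : Fin n) (F : Point d n → X) → (∀ u v → F ((u ⊕ v) ⊕ v) ≡ F u) →
    ∀ w → F w ≡ F (Vec.map (canonical i₀) w)
  even-periodic i₀ F per []      = refl
  even-periodic {suc d} i₀ F per (i ∷ w) = begin
    F (i ∷ w)                                            ≡⟨ even-periodic i₀ (λ u → F (i ∷ u)) (λ u v → per (i ∷ u) (zer ∷ v)) w ⟩
    G i                                                  ≡⟨ cong G (shift-subFin i₀ i) ⟨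
    G (shift i₀ (toℕ (subFin i i₀)))                     ≡⟨ periodic (λ k → G (shift i₀ k)) 2 (λ k → advance (shift i₀ k)) (toℕ (subFin i i₀)) ⟩
    G (shift i₀ (toℕ (subFin i i₀) % 2))                 ≡⟨ cong (λ k → G (shift i₀ k)) (toℕ-mod (toℕ (subFin i i₀)) 2) ⟨
    G (canonical i₀ i)                                   ∎
    where
    open ≡-Reasoning
    w′ = Vec.map (canonical i₀) w
    G = λ j → F (j ∷ w′)
    advance : ∀ j → G (next (next j)) ≡ G j
    advance j = trans (cong (λ u → F (next (next j) ∷ u)) (sym (trans (cong (_⊕ replicate d zer) (⊕-replicate-zer w′)) (⊕-replicate-zer w′))))
      (per (j ∷ w′) (plus ∷ replicate d zer))

  -- Connects the representatives with the parity vector read by `psLabel` when the translation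
  -- vector is constantly i₀.
  removeAt-⊖-replicate : ∀ {d} i₀ (x : Point (suc d) n) r →
    Vec.map (canonical i₀) (removeAt x r) ≡
    Vec.map (λ k → shift i₀ (toℕ k)) (Vec.map (λ t → toℕ t mod 2) (removeAt (x ⊖ replicate (suc d) i₀) r))
  removeAt-⊖-replicate i₀ (i ∷ x)             zero    = canonical-⊖ x
    where
    canonical-⊖ : ∀ {d} (x : Point d n) → Vec.map (canonical i₀) x ≡
      Vec.map (λ k → shift i₀ (toℕ k)) (Vec.map (λ t → toℕ t mod 2) (x ⊖ replicate d i₀))
    canonical-⊖ []      = refl
    canonical-⊖ (i ∷ x) = cong (canonical i₀ i ∷_) (canonical-⊖ x)
  removeAt-⊖-replicate i₀ (i ∷ x@(_ ∷ _)) (suc r) = cong (canonical i₀ i ∷_) (removeAt-⊖-replicate i₀ x r)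

  module _ {d} (L : Labeling (suc d) n) (tight : Tight L) (alternating : Alternating (λ p → sgn (L p))) where

    private
      r = proj₁ alternating
      g = proj₁ (proj₂ alternating)
      f≡g = proj₁ (proj₂ (proj₂ alternating))
      alt = proj₂ (proj₂ (proj₂ alternating))

    sgn-step : ∀ q y → lookup y r ≡ plus → sgn (L (q ⊕ y)) ≡ - sgn (L q)
    sgn-step q y eq = begin
      sgn (L (q ⊕ y))                         ≡⟨ f≡g (q ⊕ y) ⟩
      g (lookup (q ⊕ y) r)                    ≡⟨ cong g (lookup-zipWith addDir r q y) ⟩
      g (addDir (lookup q r) (lookup y r))    ≡⟨ cong (λ e → g (addDir (lookup q r) e)) eq ⟩
      g (next (lookup q r))                   ≡⟨ alt (lookup q r) ⟩
      - g (lookup q r)                        ≡⟨ cong -_ (f≡g q) ⟨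
      - sgn (L q)                             ∎
      where open ≡-Reasoning

    -- Tightness is applied at the centre `q ⊕ y`, whose neighbours along y are q and q + 2y; the
    -- signs alternate along these three points.
    double-step : ∀ q y → lookup y r ≡ plus → L ((q ⊕ y) ⊕ y) ≡ flip (L q)
    double-step q y eq = gap-zero⇒flip (L q) (L (q ⊕ y)) (L ((q ⊕ y) ⊕ y)) (sgn-step q y eq) (sgn-step (q ⊕ y) y eq)
      (subst (λ t → gap (L t) (L (q ⊕ y)) (L ((q ⊕ y) ⊕ y)) ≡ 0ℤ) (⊕-negate q y) (tight (q ⊕ y) y))

    private
      K : Fin n → Point d n → Label
      K s w = L (insertAt w r s)

    K-double-step : ∀ s w v → K (next (next s)) ((w ⊕ v) ⊕ v) ≡ flip (K s w)
    K-double-step s w v = trans (cong L (sym (trans (cong (_⊕ insertAt v r plus) (insertAt-⊕ w v r s plus))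
      (insertAt-⊕ (w ⊕ v) v r (next s) plus)))) (double-step (insertAt w r s) (insertAt v r plus) (insertAt-lookup v r plus))

    K-flip : ∀ s w → K (next (next s)) w ≡ flip (K s w)
    K-flip s w = trans (cong (K (next (next s))) (sym (trans (cong (_⊕ replicate d zer) (⊕-replicate-zer w)) (⊕-replicate-zer w))))
      (K-double-step s w (replicate d zer))

    -- Two steps up flip the letter whether or not the other coordinates move by 2v; comparing the
    -- two and cancelling the flip isolates the move by 2v.
    K-periodic : ∀ s w v → K s ((w ⊕ v) ⊕ v) ≡ K s w
    K-periodic s w v = begin
      K s ((w ⊕ v) ⊕ v)                             ≡⟨ flip-involutive _ ⟨
      flip (flip (K s ((w ⊕ v) ⊕ v)))               ≡⟨ cong flip (K-flip s ((w ⊕ v) ⊕ v)) ⟨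
      flip (K (next (next s)) ((w ⊕ v) ⊕ v))        ≡⟨ cong flip (K-double-step s w v) ⟩
      flip (flip (K s w))                           ≡⟨ flip-involutive _ ⟩
      K s w                                         ∎
      where open ≡-Reasoning

    sgn-K : ∀ s w → sgn (K s w) ≡ g s
    sgn-K s w = trans (f≡g (insertAt w r s)) (cong g (insertAt-lookup w r s))

    -- Since the signs alternate, A occupies one of the first two heights; heights are counted from
    -- there.
    origin : ∃ λ i → g i ≡ 1ℤ
    origin with sgn-isSign (K zero (replicate d zero))
    ... | inj₁ eq = zero , trans (sym (sgn-K zero (replicate d zero))) eq
    ... | inj₂ eq = next zero , trans (alt zero) (cong -_ (trans (sym (sgn-K zero (replicate d zero))) eq))

    private
      i₀ = proj₁ origin
      -- Heights are natural numbers, so that the period 4 of the letters can be compared with the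
      -- length n of the cycle.
      h : ℕ → Point d n → Label
      h k w = K (shift i₀ k) w

    h0≡A : ∀ w → h 0 w ≡ A
    h0≡A w = sgn≡1⇒A (trans (sgn-K i₀ w) (proj₂ origin))

    h1≢A : ∀ w → h 1 w ≢ A
    h1≢A w eq with trans (sym (cong sgn eq)) (trans (sgn-K (next i₀) w) (trans (alt i₀) (cong -_ (proj₂ origin))))
    ... | ()

    h2≡A : ∀ w → h 2 w ≡ A
    h2≡A w = trans (K-flip i₀ w) (cong flip (h0≡A w))

    h-mod4 : ∀ w k → h k w ≡ h (k % 4) w
    h-mod4 w = periodic (λ k → h k w) 4 λ k → trans (K-flip (shift i₀ (2 ℕ.+ k)) w)
      (trans (cong flip (K-flip (shift i₀ k) w)) (flip-involutive (h k w)))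

    -- Going once round the cycle, the letter at height 1 + (n mod 4) equals the one at height 1,
    -- which is not A. Residues 1 and 3 lead to an even height, which carries A; residue 2 leads to
    -- height 3, which carries the flipped letter.
    4∣n : 4 ∣ n
    4∣n = residue (n % 4) refl (m%n<n n 4)
      where
      w₀ = replicate d i₀
      around : h (suc (n % 4)) w₀ ≡ h 1 w₀
      around = begin
        h (suc (n % 4)) w₀              ≡⟨ h-mod4 w₀ (suc (n % 4)) ⟩
        h (suc (n % 4) % 4) w₀          ≡⟨ cong (λ k → h k w₀) (trans (cong (_% 4) (ℕ.+-comm 1 (n % 4))) ([m%n+o]%n≡[m+o]%n n 1 4)) ⟩
        h ((n ℕ.+ 1) % 4) w₀            ≡⟨ h-mod4 w₀ (n ℕ.+ 1) ⟨
        h (n ℕ.+ 1) w₀                  ≡⟨ cong (λ k → h k w₀) (ℕ.+-comm n 1) ⟩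
        K (next (shift i₀ n)) w₀        ≡⟨ cong (λ i → K (next i) w₀) (shift-n i₀) ⟩
        h 1 w₀                          ∎
        where open ≡-Reasoning
      residue : ∀ ρ → n % 4 ≡ ρ → ρ ℕ.< 4 → 4 ∣ n
      residue 0 eq _ = m%n≡0⇒n∣m n 4 eq
      residue 1 eq _ = contradiction (trans (sym around′) (h2≡A w₀)) (h1≢A w₀)
        where around′ = subst (λ ρ → h (suc ρ) w₀ ≡ h 1 w₀) eq around
      residue 2 eq _ = contradiction (flip-fixed⇒A (trans (sym (K-flip (next i₀) w₀)) around′)) (h1≢A w₀)
        where around′ = subst (λ ρ → h (suc ρ) w₀ ≡ h 1 w₀) eq around
      residue 3 eq _ = contradiction (trans (sym around′) (trans (h-mod4 w₀ 4) (h0≡A w₀))) (h1≢A w₀)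
        where around′ = subst (λ ρ → h (suc ρ) w₀ ≡ h 1 w₀) eq around
      residue (suc (suc (suc (suc _)))) _ (ℕ.s≤s (ℕ.s≤s (ℕ.s≤s (ℕ.s≤s ()))))

    h≡psLetter : ∀ w k → h k w ≡ psLetter k (epsOf (h 1 w))
    h≡psLetter w k = trans (h-mod4 w k) (trans (residue (k % 4) (m%n<n k 4)) (psLetter-cong (k % 4) k (epsOf (h 1 w)) (m%n%n≡m%n k 4)))
      where
      residue : ∀ ρ → ρ ℕ.< 4 → h ρ w ≡ psLetter ρ (epsOf (h 1 w))
      residue 0 _ = h0≡A w
      residue 1 _ = sym (proj₁ (psLetter-epsOf (h 1 w) (h1≢A w)))
      residue 2 _ = h2≡A w
      residue 3 _ = trans (K-flip (next i₀) w) (sym (proj₂ (psLetter-epsOf (h 1 w) (h1≢A w))))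
      residue (suc (suc (suc (suc _)))) (ℕ.s≤s (ℕ.s≤s (ℕ.s≤s (ℕ.s≤s ()))))

    -- The translation vector is i₀ in every coordinate: in coordinate r this is a height of A, and
    -- in the others it is merely the base point from which parities are counted.
    extremal⇒GenPS : GenPS L
    extremal⇒GenPS = r , replicate (suc d) i₀ , ε , λ x →
      let s = toℕ (subFin (lookup x r) i₀)
          y = Vec.map (λ t → toℕ t mod 2) (removeAt (x ⊖ replicate (suc d) i₀) r)
          w = Vec.map (λ k → shift i₀ (toℕ k)) y
      in begin
        L x                                     ≡⟨ cong L (insertAt-removeAt x r) ⟨
        K (lookup x r) (removeAt x r)           ≡⟨ even-periodic i₀ (K (lookup x r)) (K-periodic (lookup x r)) (removeAt x r) ⟩
        K (lookup x r) (Vec.map (canonical i₀) (removeAt x r))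
                                                ≡⟨ cong₂ K (sym (shift-subFin i₀ (lookup x r))) (removeAt-⊖-replicate i₀ x r) ⟩
        h s w                                   ≡⟨ h≡psLetter w s ⟩
        psLetter s (ε y)                        ≡⟨ cong (λ t → psLetter (toℕ t) (ε y)) (lookup-⊖ x) ⟨
        psLabel r (replicate (suc d) i₀) ε x    ∎
      where
      open ≡-Reasoning
      ε : Vec (Fin 2) d → Eps
      -- The choice is read one step above the origin, over the representative of the parity class
      -- y.
      ε y = epsOf (h 1 (Vec.map (λ k → shift i₀ (toℕ k)) y))
      lookup-⊖ : ∀ x → lookup (x ⊖ replicate (suc d) i₀) r ≡ subFin (lookup x r) i₀
      lookup-⊖ x = trans (lookup-zipWith subFin r x _) (cong (subFin (lookup x r)) (lookup-replicate r i₀))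

-- Patchell–Spiro labelings are extremal

∀-eps? : {P : Eps → Set} → (∀ e → Dec (P e)) → Dec (∀ e → P e)
∀-eps? P? with P? one | P? three
... | yes p | yes q = yes λ { one → p ; three → q }
... | no ¬p | _     = no λ all → ¬p (all one)
... | _     | no ¬q = no λ all → ¬q (all three)

-- Reduces heights to `Fin 4`, where all cases can be evaluated.
psLetter-+ : ∀ s k e → psLetter (s ℕ.+ k) e ≡ psLetter (toℕ (s mod 4) ℕ.+ k) e
psLetter-+ s k e = psLetter-cong (s ℕ.+ k) (toℕ (s mod 4) ℕ.+ k) e (sym (trans (cong (λ t → (t ℕ.+ k) % 4) (toℕ-mod s 4)) ([m%n+o]%n≡[m+o]%n s k 4)))

-- The choice only decides between C and T, which have equal sign.
sgn-psLetter : ∀ s e e′ → sgn (psLetter s e) ≡ sgn (psLetter s e′)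
sgn-psLetter s e e′ with s % 2 ≡ᵇ 0
... | true = refl
... | false with s % 4 ≡ᵇ epsVal e | s % 4 ≡ᵇ epsVal e′
...   | true  | true  = refl
...   | true  | false = refl
...   | false | true  = refl
...   | false | false = refl

sgn-psLetter-+1 : ∀ s e → sgn (psLetter (s ℕ.+ 1) e) ≡ - sgn (psLetter s e)
sgn-psLetter-+1 s e = begin
  sgn (psLetter (s ℕ.+ 1) e)                   ≡⟨ cong sgn (psLetter-+ s 1 e) ⟩
  sgn (psLetter (toℕ (s mod 4) ℕ.+ 1) e)       ≡⟨ toWitness {a? = all? λ u → ∀-eps? λ e → sgn (psLetter (toℕ u ℕ.+ 1) e) ≟ - sgn (psLetter (toℕ u ℕ.+ 0) e)} _ (s mod 4) e ⟩
  - sgn (psLetter (toℕ (s mod 4) ℕ.+ 0) e)     ≡⟨ cong (λ t → - sgn t) (psLetter-+ s 0 e) ⟨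
  - sgn (psLetter (s ℕ.+ 0) e)                 ≡⟨ cong (λ t → - sgn (psLetter t e)) (ℕ.+-identityʳ s) ⟩
  - sgn (psLetter s e)                         ∎
  where open ≡-Reasoning

gap-cong : ∀ {a a′ b b′ c c′} → a ≡ a′ → b ≡ b′ → c ≡ c′ → gap a b c ≡ 0ℤ → gap a′ b′ c′ ≡ 0ℤ
gap-cong refl refl refl eq = eq

-- The ends share the choice e because p - y and p + y differ by 2y and so have equal parities; the
-- centre has its own choice e′.
progression-gap : ℕ → ℕ → ℕ → Eps → Eps → ℕ → ℤ
progression-gap j k l e e′ u = gap (psLetter (u ℕ.+ j) e) (psLetter (u ℕ.+ k) e′) (psLetter (u ℕ.+ l) e)

progression-gap-mod4 : ∀ j k l e e′ s →
  progression-gap j k l e e′ (toℕ (s mod 4)) ≡ 0ℤ → progression-gap j k l e e′ s ≡ 0ℤ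
progression-gap-mod4 j k l e e′ s = gap-cong
  (sym (psLetter-+ s j e)) (sym (psLetter-+ s k e′)) (sym (psLetter-+ s l e))

opaque

  unfolding gap

  progression-gap? : ∀ j k l → Dec (∀ (u : Fin 4) e e′ → progression-gap j k l e e′ (toℕ u) ≡ 0ℤ)
  progression-gap? j k l = all? λ u → ∀-eps? λ e → ∀-eps? λ e′ → progression-gap j k l e e′ (toℕ u) ≟ 0ℤ

  stationary-gap : ∀ s e e′ → progression-gap 0 0 0 e e′ s ≡ 0ℤ
  stationary-gap s e e′ = progression-gap-mod4 0 0 0 e e′ s (toWitness {a? = progression-gap? 0 0 0} _ (s mod 4) e e′)

  increasing-gap : ∀ s e e′ → progression-gap 0 1 2 e e′ s ≡ 0ℤ
  increasing-gap s e e′ = progression-gap-mod4 0 1 2 e e′ s (toWitness {a? = progression-gap? 0 1 2} _ (s mod 4) e e′)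

  decreasing-gap : ∀ s e e′ → progression-gap 2 1 0 e e′ s ≡ 0ℤ
  decreasing-gap s e e′ = progression-gap-mod4 2 1 0 e e′ s (toWitness {a? = progression-gap? 2 1 0} _ (s mod 4) e e′)

[m%n+o]%c≡[m+o]%c : ∀ {c n} .{{_ : NonZero c}} .{{_ : NonZero n}} → c ∣ n → ∀ k l → (k % n ℕ.+ l) % c ≡ (k ℕ.+ l) % c
[m%n+o]%c≡[m+o]%c {c} {n} c∣n k l = begin
  (k % n ℕ.+ l) % c         ≡⟨ [m%n+o]%n≡[m+o]%n (k % n) l c ⟨
  (k % n % c ℕ.+ l) % c     ≡⟨ cong (λ t → (t ℕ.+ l) % c) (m∣n⇒o%n%m≡o%m c n k c∣n) ⟩
  (k % c ℕ.+ l) % c         ≡⟨ [m%n+o]%n≡[m+o]%n k l c ⟩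
  (k ℕ.+ l) % c             ∎
  where open ≡-Reasoning

module _ {m : ℕ} where

  private n = suc m

  -- Wrapping round the cycle changes a height by a multiple of n, which is invisible modulo a
  -- divisor c of n.
  subFin-next : ∀ {c} .{{_ : NonZero c}} → c ∣ n → ∀ a i →
    toℕ (subFin (next i) a) % c ≡ (toℕ (subFin i a) ℕ.+ 1) % c
  subFin-next {c} c∣n a i = begin
    toℕ (subFin (next i) a) % c                      ≡⟨ cong (_% c) (toℕ-mod (toℕ (next i) ℕ.+ D) n) ⟩
    (toℕ (next i) ℕ.+ D) % n % c                     ≡⟨ m∣n⇒o%n%m≡o%m c n (toℕ (next i) ℕ.+ D) c∣n ⟩
    (toℕ (next i) ℕ.+ D) % c                         ≡⟨ cong (λ t → (t ℕ.+ D) % c) (toℕ-mod (toℕ i ℕ.+ 1) n) ⟩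
    ((toℕ i ℕ.+ 1) % n ℕ.+ D) % c                    ≡⟨ [m%n+o]%c≡[m+o]%c c∣n (toℕ i ℕ.+ 1) D ⟩
    (toℕ i ℕ.+ 1 ℕ.+ D) % c                          ≡⟨ cong (_% c) (trans (ℕ.+-assoc (toℕ i) 1 D) (trans (cong (toℕ i ℕ.+_) (ℕ.+-comm 1 D)) (sym (ℕ.+-assoc (toℕ i) D 1)))) ⟩
    (toℕ i ℕ.+ D ℕ.+ 1) % c                          ≡⟨ [m%n+o]%c≡[m+o]%c c∣n (toℕ i ℕ.+ D) 1 ⟨
    ((toℕ i ℕ.+ D) % n ℕ.+ 1) % c                    ≡⟨ cong (λ t → (t ℕ.+ 1) % c) (toℕ-mod (toℕ i ℕ.+ D) n) ⟨
    (toℕ (subFin i a) ℕ.+ 1) % c                     ∎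
    where
    open ≡-Reasoning
    D = n ℕ.∸ toℕ a

  subFin-from-prev : ∀ {c} .{{_ : NonZero c}} → c ∣ n → ∀ a i →
    toℕ (subFin i a) % c ≡ (toℕ (subFin (addDir i minus) a) ℕ.+ 1) % c
  subFin-from-prev {c} c∣n a i = subst (λ t → toℕ (subFin t a) % c ≡ (toℕ (subFin (addDir i minus) a) ℕ.+ 1) % c)
    (addDir-neg minus i) (subFin-next c∣n a (addDir i minus))

  subFin-across : ∀ {c} .{{_ : NonZero c}} → c ∣ n → ∀ a i →
    toℕ (subFin (next i) a) % c ≡ (toℕ (subFin (addDir i minus) a) ℕ.+ 2) % c
  subFin-across {c} c∣n a i = begin
    toℕ (subFin (next i) a) % c          ≡⟨ subFin-next c∣n a i ⟩
    (toℕ (subFin i a) ℕ.+ 1) % c         ≡⟨ [m%n+o]%n≡[m+o]%n (toℕ (subFin i a)) 1 c ⟨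
    (toℕ (subFin i a) % c ℕ.+ 1) % c     ≡⟨ cong (λ t → (t ℕ.+ 1) % c) (subFin-from-prev c∣n a i) ⟩
    ((u ℕ.+ 1) % c ℕ.+ 1) % c            ≡⟨ [m%n+o]%n≡[m+o]%n (u ℕ.+ 1) 1 c ⟩
    (u ℕ.+ 1 ℕ.+ 1) % c                  ≡⟨ cong (_% c) (ℕ.+-assoc u 1 1) ⟩
    (u ℕ.+ 2) % c                        ∎
    where
    open ≡-Reasoning
    u = toℕ (subFin (addDir i minus) a)

  parity-across : 2 ∣ n → ∀ a i e → toℕ (subFin (addDir i (neg e)) a) mod 2 ≡ toℕ (subFin (addDir i e) a) mod 2
  parity-across 2∣n a i zer   = refl
  parity-across 2∣n a i plus  = toℕ-injective (begin
    toℕ (u mod 2)                           ≡⟨ toℕ-mod u 2 ⟩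
    u % 2                                   ≡⟨ [m+n]%n≡m%n u 2 ⟨
    (u ℕ.+ 2) % 2                           ≡⟨ subFin-across 2∣n a i ⟨
    toℕ (subFin (next i) a) % 2             ≡⟨ toℕ-mod (toℕ (subFin (next i) a)) 2 ⟨
    toℕ (toℕ (subFin (next i) a) mod 2)     ∎)
    where
    open ≡-Reasoning
    u = toℕ (subFin (addDir i minus) a)
  parity-across 2∣n a i minus = sym (parity-across 2∣n a i plus)

  module _ {d} (4∣n : 4 ∣ n) (L : Labeling (suc d) n) (genPS : GenPS L) where

    private
      r = proj₁ genPS
      a = proj₁ (proj₂ genPS)
      ε = proj₁ (proj₂ (proj₂ genPS))
      L≡ps = proj₂ (proj₂ (proj₂ genPS))
      2∣n : 2 ∣ n
      2∣n = ∣-trans (divides 2 refl) 4∣n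
      φ : Fin n → ℕ
      φ i = toℕ (subFin i (lookup a r))
      parity : Fin n → Fin 2
      parity t = toℕ t mod 2
      εAt : Point (suc d) n → Eps
      εAt x = ε (Vec.map parity (removeAt (x ⊖ a) r))

    L≡psLetter : ∀ x → L x ≡ psLetter (φ (lookup x r)) (εAt x)
    L≡psLetter x = trans (L≡ps x) (cong (λ t → psLetter (toℕ t) (εAt x)) (lookup-zipWith subFin r x a))

    L-⊕ : ∀ p y → L (p ⊕ y) ≡ psLetter (φ (addDir (lookup p r) (lookup y r))) (εAt (p ⊕ y))
    L-⊕ p y = trans (L≡psLetter (p ⊕ y)) (cong (λ t → psLetter (φ t) (εAt (p ⊕ y))) (lookup-zipWith addDir r p y))

    εAt-across : ∀ p y → εAt (p ⊕ negate y) ≡ εAt (p ⊕ y)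
    εAt-across p y = cong ε (trans (map-removeAt parity ((p ⊕ negate y) ⊖ a) r)
      (trans (cong (λ v → removeAt v r) (across p y a)) (sym (map-removeAt parity ((p ⊕ y) ⊖ a) r))))
      where
      across : ∀ {k} (p : Point k n) y a → Vec.map parity ((p ⊕ negate y) ⊖ a) ≡ Vec.map parity ((p ⊕ y) ⊖ a)
      across []      []      []      = refl
      across (i ∷ p) (e ∷ y) (b ∷ a) = cong₂ _∷_ (parity-across 2∣n b i e) (across p y a)

    GenPS⇒alternating : Alternating (λ p → sgn (L p))
    -- Signs do not depend on the choice, so the constant `one` can replace ε.
    GenPS⇒alternating = r , (λ i → sgn (psLetter (φ i) one)) ,
      (λ p → trans (cong sgn (L≡psLetter p)) (sgn-psLetter (φ (lookup p r)) (εAt p) one)) ,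
      (λ i → trans (cong sgn (psLetter-cong (φ (next i)) (φ i ℕ.+ 1) one (subFin-next 4∣n (lookup a r) i))) (sgn-psLetter-+1 (φ i) one))

    -- Along coordinate r the heights of p - y, p, p + y are stationary, increasing or decreasing by
    -- single steps, and each pattern was checked modulo 4.
    GenPS⇒tight : Tight L
    GenPS⇒tight p y = gap-cong
      (sym (trans (L-⊕ p (negate y)) (cong₂ psLetter (cong (λ e → φ (addDir i e)) (lookup-map r neg y)) (εAt-across p y))))
      (sym (L≡psLetter p)) (sym (L-⊕ p y)) (letters (lookup y r) (εAt (p ⊕ y)) (εAt p))
      where
      i = lookup p r
      -- Counting from the predecessor makes the offsets 0, 1, 2 natural numbers.
      u = φ (addDir i minus)
      at0 : ∀ s e → psLetter (s ℕ.+ 0) e ≡ psLetter s e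
      at0 s e = cong (λ t → psLetter t e) (ℕ.+-identityʳ s)
      at1 : ∀ e → psLetter (u ℕ.+ 1) e ≡ psLetter (φ i) e
      at1 e = psLetter-cong (u ℕ.+ 1) (φ i) e (sym (subFin-from-prev 4∣n (lookup a r) i))
      at2 : ∀ e → psLetter (u ℕ.+ 2) e ≡ psLetter (φ (next i)) e
      at2 e = psLetter-cong (u ℕ.+ 2) (φ (next i)) e (sym (subFin-across 4∣n (lookup a r) i))
      letters : ∀ s e e′ → gap (psLetter (φ (addDir i (neg s))) e) (psLetter (φ i) e′) (psLetter (φ (addDir i s)) e) ≡ 0ℤ
      letters zer   e e′ = gap-cong (at0 (φ i) e) (at0 (φ i) e′) (at0 (φ i) e) (stationary-gap (φ i) e e′)
      letters plus  e e′ = gap-cong (at0 u e) (at1 e′) (at2 e) (increasing-gap u e e′)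
      letters minus e e′ = gap-cong (at2 e) (at1 e′) (at0 u e) (decreasing-gap u e e′)

-- The equality case and the theorem

module _ {m d : ℕ} (L : Labeling (suc d) (suc m)) where

  equality⇒GenPS : 2 ℕ.* occurrences L ≡ 3 ℕ.^ d ℕ.* suc m ℕ.^ suc d → 4 ∣ suc m × GenPS L
  equality⇒GenPS eq = let tight , alternating = equality⇒extremal L eq in
    4∣n L tight alternating , extremal⇒GenPS L tight alternating

  GenPS⇒equality : 4 ∣ suc m × GenPS L → 2 ℕ.* occurrences L ≡ 3 ℕ.^ d ℕ.* suc m ℕ.^ suc d
  GenPS⇒equality (div , genPS) = extremal⇒equality L (GenPS⇒tight div L genPS) (GenPS⇒alternating div L genPS)

theorem1p1 : (d n : ℕ) → 1 ℕ.≤ d → 3 ℕ.≤ n → (L : Labeling d n) →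
    (2 ℕ.* occurrences L ℕ.≤ 3 ℕ.^ (d ℕ.∸ 1) ℕ.* n ℕ.^ d) ×
    ((2 ℕ.* occurrences L ≡ 3 ℕ.^ (d ℕ.∸ 1) ℕ.* n ℕ.^ d) ⇔ (4 ∣ n × GenPS L))
theorem1p1 (suc d) (suc m) _ _ L = occurrences-bound L , mk⇔ (equality⇒GenPS L) (GenPS⇒equality L)
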